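{- Fix integers $n\ge 1$ and $q\geq 1$. Suppose $\ell\ge n$ is the smallest integer such that $\tilde{H}_q(\mathcal{VR}(\mathcal{F}_n^{[\ell]};2(n-1)))$ is nontrivial. Then for every $m\geq\ell$, $$\operatorname{rank}\tilde{H}_q\big(\mathcal{VR}(\mathcal{F}_n^{[m]};2(n-1))\big)\geq\sum_{i=\ell}^{m}\binom{i-2}{\ell-2}\cdot\operatorname{rank}\tilde{H}_q\big(\mathcal{VR}(\mathcal{F}_n^{[\ell]};2(n-1))\big).$$
   Context: $\mathcal{F}_n^{[m]}$ is the set of $n$-element subsets of $[m]=\{1,\dots,m\}$ with metric $d(A,B)=|A\triangle B|$. $\mathcal{VR}(X;r)$ is the simplicial complex on $X$ whose simplices are nonempty finite sets of pairwise distance $\le r$. Note $\mathcal{VR}(\mathcal{F}_n^{[2n+k]};2(n-1))$ is the independence complex of the Kneser graph $\mathrm{KG}(n,k)$. $\tilde H_q$ denotes reduced simplicial homology with real coefficients, and rank means dimension.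
   Formalization: Reduced homology is taken with rational instead of real coefficients; the ranks are the same, since the boundary matrices have integer entries. -}

module Defs where

open import Data.Nat using (ℕ; zero; suc; _+_; _∸_; _≤_)
open import Data.Bool using (Bool; true; false)
import Data.Bool.Properties as BoolP
open import Data.Vec using (Vec; []; _∷_)
import Data.Vec.Properties as VecP
open import Data.Fin using (Fin)
open import Data.Fin.Subset using (Subset; _∪_; _─_; ∣_∣)
open import Data.List using (List; []; _∷_; length; map; concatMap; upTo; _++_)
open import Data.Nat.ListAction using (sum)
import Data.List.Properties as ListP
open import Data.List.Relation.Unary.All using (All)
open import Data.List.Relation.Unary.AllPairs using (AllPairs)
open import Data.Rational using (ℚ; 0ℚ; 1ℚ; -_) renaming (_+_ to _+ℚ_; _*_ to _*ℚ_)
open import Data.Product using (Σ; ∃; _×_; _,_)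
open import Relation.Nullary using (¬_; yes; no)
open import Relation.Binary.PropositionalEquality using (_≡_)

sumFromTo : ℕ → ℕ → (ℕ → ℕ) → ℕ
sumFromTo a b f = sum (map (λ j → f (a + j)) (upTo (suc b ∸ a)))

-- The metric space F_n^[m]: subsets of [m] (as characteristic vectors)
-- with d(A,B) = |A △ B|.

dist : ∀ {m} → Subset m → Subset m → ℕ
dist A B = ∣ (A ─ B) ∪ (B ─ A) ∣

-- A fixed strict total order on subsets (lexicographic), used only to
-- choose a canonical orientation of each simplex.
data _<ˡ_ : ∀ {m} → Subset m → Subset m → Set where
  here  : ∀ {m} {A B : Subset m} → (false ∷ A) <ˡ (true ∷ B)
  there : ∀ {m} {b} {A B : Subset m} → A <ˡ B → (b ∷ A) <ˡ (b ∷ B)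

-- Oriented simplices of VR(F_n^[m]; r): strictly increasing lists of
-- vertices (n-subsets of [m]) with pairwise distance ≤ r.
-- The empty list is the (-1)-simplex of the augmented chain complex.

Simplex : ℕ → Set
Simplex m = List (Subset m)

IsSimplex : (m n r q : ℕ) → Simplex m → Set
IsSimplex m n r q σ =
  length σ ≡ suc q ×
  All (λ A → ∣ A ∣ ≡ n) σ ×
  AllPairs (λ A B → (A <ˡ B) × (dist A B ≤ r)) σ

_≟σ_ : ∀ {m} (σ τ : Simplex m) → Relation.Nullary.Dec (σ ≡ τ)
_≟σ_ = ListP.≡-dec (VecP.≡-dec BoolP._≟_)

Chain : ℕ → Set
Chain m = List (ℚ × Simplex m)

coeff : ∀ {m} → Chain m → Simplex m → ℚ
coeff [] τ = 0ℚ
coeff ((a , σ) ∷ c) τ with σ ≟σ τ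
... | yes _ = a +ℚ coeff c τ
... | no  _ = coeff c τ

-- signed faces: ∂[v0,…,vq] = Σ_i (-1)^i [v0,…,v̂i,…,vq]
faces : ∀ {m} → Simplex m → Chain m
faces [] = []
faces (v ∷ σ) = (1ℚ , σ) ∷ map (λ { (a , τ) → (- a , v ∷ τ) }) (faces σ)

scale : ∀ {m} → ℚ → Chain m → Chain m
scale a c = map (λ { (b , τ) → (a *ℚ b , τ) }) c

-- boundary map (augmented: the boundary of a vertex is the empty simplex)
∂ : ∀ {m} → Chain m → Chain m
∂ c = concatMap (λ { (a , σ) → scale a (faces σ) }) c

lincomb : ∀ {m} (k : ℕ) → (Fin k → ℚ) → (Fin k → Chain m) → Chain m
lincomb zero a z = []
lincomb (suc k) a z = scale (a Fin.zero) (z Fin.zero) ++ lincomb k (λ i → a (Fin.suc i)) (λ i → z (Fin.suc i))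
  where import Data.Fin as Fin

IsChain : (m n r q : ℕ) → Chain m → Set
IsChain m n r q c = All (λ { (_ , σ) → IsSimplex m n r q σ }) c

IsCycle : (m n r q : ℕ) → Chain m → Set
IsCycle m n r q c = IsChain m n r q c × (∀ τ → coeff (∂ c) τ ≡ 0ℚ)

IsBoundary : (m n r q : ℕ) → Chain m → Set
IsBoundary m n r q c =
  ∃ λ (d : Chain m) → IsChain m n r (suc q) d × (∀ τ → coeff (∂ d) τ ≡ coeff c τ)

-- there are k q-cycles whose classes in H̃_q are linearly independent,
-- i.e. rank H̃_q(VR(F_n^[m]; r); ℚ) ≥ k
RankAtLeast : (m n r q k : ℕ) → Set
RankAtLeast m n r q k =
  ∃ λ (z : Fin k → Chain m) →
    (∀ i → IsCycle m n r q (z i)) ×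
    (∀ (a : Fin k → ℚ) → IsBoundary m n r q (lincomb k a z) → ∀ i → a i ≡ 0ℚ)

RankEq : (m n r q k : ℕ) → Set
RankEq m n r q k = RankAtLeast m n r q k × ¬ RankAtLeast m n r q (suc k)

Nontrivial : (m n r q : ℕ) → Set
Nontrivial m n r q = RankAtLeast m n r q 1

{-# OPTIONS --safe #-}
module Submission where

-- Every map f : [m] → [k] with n ≤ k induces a map in homology: send an n-set A
-- to any n-set containing f A. This preserves the relation of meeting, and any
-- two choices are contiguous, so maps that miss a point of [ℓ] induce zero by
-- minimality of ℓ. Let S run over the ℓ-subsets of [m] containing m, and let
-- ρ_S : [m] → S send x to the least element of S that is ≥ x. Then ρ_S is the
-- identity on S, and for a suitable order of the sets S the restriction of ρ_S
-- to any later S′ is not onto S. This triangularity makes the r cycles copied to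
-- each S jointly independent, and there are C(m-1, ℓ-1) = Σᵢ C(i-2, ℓ-2) sets S.
-- Constructively the minimality only gives that cycles on ℓ-1 points do not fail
-- to bound; this suffices because equality in ℚ is decidable.

open import Defs
open import Data.Nat using (ℕ; zero; suc; _+_; _≤_; _<_; _∸_; _*_; z≤n; s≤s)
open import Data.Nat.Combinatorics using (_C_; nCn≡1; nCk≡nC[n∸k]; k>n⇒nCk≡0; nCk+nC[k+1]≡[n+1]C[k+1])
open import Data.Nat.ListAction using (sum)
open import Data.Nat.ListAction.Properties using (sum-++)
import Data.Nat.Properties as ℕₚ
open import Data.Bool using (true; false)
open import Data.Empty using (⊥-elim)
open import Data.Fin using (Fin; zero; suc; splitAt; join; lift; _↑ˡ_; _↑ʳ_)
import Data.Fin.Properties as Finₚ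
open import Data.Fin.Subset using (Subset; ∣_∣; _∈_; ⁅_⁆; _∪_; ⊥)
import Data.Fin.Subset.Properties as Subsetₚ
open import Data.List using (List; []; _∷_; _++_; length; map; upTo)
import Data.List.Properties as Listₚ
open import Data.List.Membership.Propositional renaming (_∈_ to _∈ₗ_)
open import Data.List.Relation.Unary.All as All using (All; []; _∷_)
import Data.List.Relation.Unary.All.Properties as Allₚ
open import Data.List.Relation.Unary.Any using (here; there)
open import Data.List.Relation.Unary.AllPairs as AllPairs using (AllPairs; []; _∷_)
import Data.List.Relation.Unary.AllPairs.Properties as AllPairsₚ
open import Data.Product using (∃; _×_; _,_; proj₁; proj₂)
open import Data.Rational using (ℚ; 0ℚ; 1ℚ; -_; _-_; 1/_; ≢-nonZero) renaming (_+_ to _+ℚ_; _*_ to _*ℚ_)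
import Data.Rational.Properties as ℚₚ
open import Data.Rational.Solver using (module +-*-Solver)
open import Data.Sum using (inj₁; inj₂; [_,_]′)
open import Data.Vec using ([]; _∷_; here; there)
open import Function using (_∘_)
open import Relation.Binary.Definitions using (Trichotomous; Tri; tri<; tri≈; tri>)
open import Relation.Binary.PropositionalEquality
open import Relation.Nullary using (¬_; yes; no; contradiction; decidable-stable)

open +-*-Solver

private variable
  m k ℓ n q : ℕ

-- Chains as functionals and the coboundary.

-ℚ-congʳ : ∀ x {y z} → y ≡ z → x - y ≡ x - z
-ℚ-congʳ x = cong (λ y → x - y)

-- A chain is handled through the linear functional w ↦ eval w c that it
-- defines on functions on words; an operator on chains then becomes the
-- transposed operator on functions.

Cochain : ℕ → Set
Cochain m = Simplex m → ℚ

eval : Cochain m → Chain m → ℚ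
eval w [] = 0ℚ
eval w ((a , σ) ∷ c) = a *ℚ w σ +ℚ eval w c

AllTerms : (Simplex m → Set) → Chain m → Set
AllTerms P = All (P ∘ proj₂)

eval-cong-on : ∀ {P : Simplex m → Set} {w w′ : Cochain m} → (∀ {σ} → P σ → w σ ≡ w′ σ) →
               ∀ {c} → AllTerms P c → eval w c ≡ eval w′ c
eval-cong-on e [] = refl
eval-cong-on e {(a , σ) ∷ c} (p ∷ ps) = cong₂ _+ℚ_ (cong (a *ℚ_) (e p)) (eval-cong-on e ps)

eval-cong : {w w′ : Cochain m} → (∀ σ → w σ ≡ w′ σ) → ∀ c → eval w c ≡ eval w′ c
eval-cong e [] = refl
eval-cong e ((a , σ) ∷ c) = cong₂ _+ℚ_ (cong (a *ℚ_) (e σ)) (eval-cong e c)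

eval-++ : ∀ (w : Cochain m) c d → eval w (c ++ d) ≡ eval w c +ℚ eval w d
eval-++ w [] d = sym (ℚₚ.+-identityˡ (eval w d))
eval-++ w ((a , σ) ∷ c) d = trans (cong (a *ℚ w σ +ℚ_) (eval-++ w c d))
  (sym (ℚₚ.+-assoc (a *ℚ w σ) (eval w c) (eval w d)))

eval-scale : ∀ (w : Cochain m) a c → eval w (scale a c) ≡ a *ℚ eval w c
eval-scale w a [] = sym (ℚₚ.*-zeroʳ a)
eval-scale w a ((b , σ) ∷ c) = trans (cong (a *ℚ b *ℚ w σ +ℚ_) (eval-scale w a c))
  (solve 4 (λ a b x y → a :* b :* x :+ a :* y := a :* (b :* x :+ y)) refl a b (w σ) (eval w c))

eval-0 : ∀ (c : Chain m) → eval (λ _ → 0ℚ) c ≡ 0ℚ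
eval-0 [] = refl
eval-0 ((a , σ) ∷ c) = trans (cong₂ _+ℚ_ (ℚₚ.*-zeroʳ a) (eval-0 c)) refl

eval-sub : ∀ (w w′ : Cochain m) c → eval (λ σ → w σ - w′ σ) c ≡ eval w c - eval w′ c
eval-sub w w′ [] = refl
eval-sub w w′ ((a , σ) ∷ c) = trans (cong (a *ℚ (w σ - w′ σ) +ℚ_) (eval-sub w w′ c))
  (solve 5 (λ a x y u v → a :* (x :- y) :+ (u :- v) := a :* x :+ u :- (a :* y :+ v)) refl
    a (w σ) (w′ σ) (eval w c) (eval w′ c))

_⊖_ : Chain m → Chain m → Chain m
c ⊖ d = c ++ scale (- 1ℚ) d

eval-⊖ : ∀ (w : Cochain m) c d → eval w (c ⊖ d) ≡ eval w c - eval w d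
eval-⊖ w c d = trans (eval-++ w c (scale (- 1ℚ) d)) (trans (cong (eval w c +ℚ_) (eval-scale w (- 1ℚ) d))
  (solve 2 (λ x y → x :+ con (- 1ℚ) :* y := x :- y) refl (eval w c) (eval w d)))

ext : (Simplex m → Chain k) → Chain m → Chain k
ext φ [] = []
ext φ ((a , σ) ∷ c) = scale a (φ σ) ++ ext φ c

eval-ext : ∀ (φ : Simplex m → Chain k) w c → eval w (ext φ c) ≡ eval (λ σ → eval w (φ σ)) c
eval-ext φ w [] = refl
eval-ext φ w ((a , σ) ∷ c) = trans (eval-++ w (scale a (φ σ)) _)
  (cong₂ _+ℚ_ (eval-scale w a (φ σ)) (eval-ext φ w c))

AllTerms-scale : ∀ {P : Simplex m → Set} a {c} → AllTerms P c → AllTerms P (scale a c)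
AllTerms-scale a [] = []
AllTerms-scale a (p ∷ ps) = p ∷ AllTerms-scale a ps

AllTerms-ext : ∀ {P : Simplex m → Set} {Q : Simplex k → Set} {φ : Simplex m → Chain k} →
               (∀ {σ} → P σ → AllTerms Q (φ σ)) → ∀ {c} → AllTerms P c → AllTerms Q (ext φ c)
AllTerms-ext f [] = []
AllTerms-ext f {(a , _) ∷ _} (p ∷ ps) = Allₚ.++⁺ (AllTerms-scale a (f p)) (AllTerms-ext f ps)

negCons : Subset m → Chain m → Chain m
negCons v = map (λ { (a , τ) → (- a , v ∷ τ) })

eval-negCons : ∀ (w : Cochain m) v c → eval w (negCons v c) ≡ - eval (λ τ → w (v ∷ τ)) c
eval-negCons w v [] = refl
eval-negCons w v ((a , τ) ∷ c) = trans (cong (- a *ℚ w (v ∷ τ) +ℚ_) (eval-negCons w v c))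
  (solve 3 (λ a x y → :- a :* x :+ :- y := :- (a :* x :+ y)) refl a (w (v ∷ τ)) (eval (λ σ → w (v ∷ σ)) c))

AllTerms-negCons : ∀ {P Q : Simplex m → Set} {v} → (∀ {τ} → P τ → Q (v ∷ τ)) →
                   ∀ {c} → AllTerms P c → AllTerms Q (negCons v c)
AllTerms-negCons f [] = []
AllTerms-negCons f (p ∷ ps) = f p ∷ AllTerms-negCons f ps

-- The transpose of ∂.
δ : Cochain m → Cochain m
δ w [] = 0ℚ
δ w (v ∷ σ) = w σ - δ (λ τ → w (v ∷ τ)) σ

eval-faces : ∀ (w : Cochain m) σ → eval w (faces σ) ≡ δ w σ
eval-faces w [] = refl
eval-faces w (v ∷ σ) = cong₂ _+ℚ_ (ℚₚ.*-identityˡ (w σ))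
  (trans (negated (faces σ)) (cong -_ (eval-faces (λ τ → w (v ∷ τ)) σ)))
  where
  -- The underscore is the pattern lambda inside `faces`. It is a different function from the one in
  -- `negCons`, so the induction of `eval-negCons` is repeated for it.
  negated : ∀ c → eval w (map _ c) ≡ - eval (λ τ → w (v ∷ τ)) c
  negated [] = refl
  negated ((a , τ) ∷ c) = trans (cong (- a *ℚ w (v ∷ τ) +ℚ_) (negated c))
    (solve 3 (λ a x y → :- a :* x :+ :- y := :- (a :* x :+ y)) refl a (w (v ∷ τ)) (eval (λ σ → w (v ∷ σ)) c))

eval-∂ : ∀ (w : Cochain m) c → eval w (∂ c) ≡ eval (δ w) c
eval-∂ w [] = refl
eval-∂ w ((a , σ) ∷ c) = trans (eval-++ w (scale a (faces σ)) _)
  (cong₂ _+ℚ_ (trans (eval-scale w a (faces σ)) (cong (a *ℚ_) (eval-faces w σ))) (eval-∂ w c))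

δ-cong-on : ∀ {Q : Subset m → Set} {w w′ : Cochain m} → (∀ {τ} → All Q τ → w τ ≡ w′ τ) →
            ∀ {σ} → All Q σ → δ w σ ≡ δ w′ σ
δ-cong-on e [] = refl
δ-cong-on e (x ∷ xs) = cong₂ _-_ (e xs) (δ-cong-on (λ p → e (x ∷ p)) xs)

δ-cong : {w w′ : Cochain m} → (∀ τ → w τ ≡ w′ τ) → ∀ σ → δ w σ ≡ δ w′ σ
δ-cong e [] = refl
δ-cong e (v ∷ σ) = cong₂ _-_ (e σ) (δ-cong (λ τ → e (v ∷ τ)) σ)

δ-sub : ∀ (w w′ : Cochain m) σ → δ (λ τ → w τ - w′ τ) σ ≡ δ w σ - δ w′ σ
δ-sub w w′ [] = refl
δ-sub w w′ (v ∷ σ) = trans (cong (λ x → w σ - w′ σ - x) (δ-sub (λ τ → w (v ∷ τ)) (λ τ → w′ (v ∷ τ)) σ))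
  (solve 4 (λ a b c d → a :- b :- (c :- d) := a :- c :- (b :- d)) refl (w σ) (w′ σ)
    (δ (λ τ → w (v ∷ τ)) σ) (δ (λ τ → w′ (v ∷ τ)) σ))

δ-0 : ∀ (σ : Simplex m) → δ (λ _ → 0ℚ) σ ≡ 0ℚ
δ-0 [] = refl
δ-0 (v ∷ σ) = cong (λ x → 0ℚ - x) (δ-0 σ)

δ-neg : ∀ (w : Cochain m) σ → δ (λ τ → - w τ) σ ≡ - δ w σ
δ-neg w [] = refl
δ-neg w (v ∷ σ) = trans (cong (λ x → - w σ - x) (δ-neg (λ τ → w (v ∷ τ)) σ))
  (solve 2 (λ a b → :- a :- :- b := :- (a :- b)) refl (w σ) (δ (λ τ → w (v ∷ τ)) σ))

-- On arbitrary words a vertex map commutes with the boundary on the nose, since disorder and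
-- repetitions are allowed there. They are dealt with once and for all by `sort`.
δ-map : ∀ (f : Subset m → Subset k) (w : Cochain k) σ → δ w (map f σ) ≡ δ (w ∘ map f) σ
δ-map f w [] = refl
δ-map f w (v ∷ σ) = cong (λ x → w (map f σ) - x) (δ-map f (λ τ → w (f v ∷ τ)) σ)

-- From coefficients to functionals.

-- Coefficients determine a chain: peel off one word at a time.

erase : Simplex m → Chain m → Chain m
erase σ [] = []
erase σ ((a , τ) ∷ c) with τ ≟σ σ
... | yes _ = erase σ c
... | no  _ = (a , τ) ∷ erase σ c

length-erase : ∀ σ (c : Chain m) → length (erase σ c) ≤ length c
length-erase σ [] = z≤n
length-erase σ ((a , τ) ∷ c) with τ ≟σ σ
... | yes _ = ℕₚ.m≤n⇒m≤1+n (length-erase σ c)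
... | no  _ = s≤s (length-erase σ c)

eval-erase : ∀ (w : Cochain m) σ c → eval w c ≡ coeff c σ *ℚ w σ +ℚ eval w (erase σ c)
eval-erase w σ [] = sym (trans (cong (_+ℚ 0ℚ) (ℚₚ.*-zeroˡ (w σ))) refl)
eval-erase w σ ((a , τ) ∷ c) with τ ≟σ σ
... | yes refl = trans (cong (a *ℚ w σ +ℚ_) (eval-erase w σ c))
  (solve 4 (λ a b x y → a :* x :+ (b :* x :+ y) := (a :+ b) :* x :+ y) refl
    a (coeff c σ) (w σ) (eval w (erase σ c)))
... | no _ = trans (cong (a *ℚ w τ +ℚ_) (eval-erase w σ c))
  (solve 3 (λ x y z → x :+ (y :+ z) := y :+ (x :+ z)) refl
    (a *ℚ w τ) (coeff c σ *ℚ w σ) (eval w (erase σ c)))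

coeff-erase : ∀ σ (c : Chain m) τ → coeff c τ ≡ 0ℚ → coeff (erase σ c) τ ≡ 0ℚ
coeff-erase σ c τ c₀ with σ ≟σ τ
... | yes refl = self c
  where
  self : ∀ c → coeff (erase σ c) σ ≡ 0ℚ
  self [] = refl
  self ((a , ρ) ∷ c) with ρ ≟σ σ
  ... | yes _ = self c
  ... | no ρ≢σ with ρ ≟σ σ
  ...   | yes ρ≡σ = contradiction ρ≡σ ρ≢σ
  ...   | no _ = self c
... | no σ≢τ = trans (other c) c₀
  where
  other : ∀ c → coeff (erase σ c) τ ≡ coeff c τ
  other [] = refl
  other ((a , ρ) ∷ c) with ρ ≟σ σ
  other ((a , ρ) ∷ c) | yes refl with ρ ≟σ τ
  ... | yes ρ≡τ = contradiction ρ≡τ σ≢τ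
  ... | no _ = other c
  other ((a , ρ) ∷ c) | no _ with ρ ≟σ τ
  ... | yes _ = cong (a +ℚ_) (other c)
  ... | no _ = other c

-- Erasing the first word removes all its occurrences and changes the value by its coefficient times
-- `w σ`, which is zero. The remainder is shorter but not a subterm, hence the induction on a length
-- bound.
coeff≡0⇒eval≡0 : ∀ (w : Cochain m) c → (∀ τ → coeff c τ ≡ 0ℚ) → eval w c ≡ 0ℚ
coeff≡0⇒eval≡0 w c c₀ = go (length c) c ℕₚ.≤-refl c₀
  where
  go : ∀ N c → length c ≤ N → (∀ τ → coeff c τ ≡ 0ℚ) → eval w c ≡ 0ℚ
  go N [] _ _ = refl
  go (suc N) c@((a , σ) ∷ c′) (s≤s len) c₀ = begin
    eval w c                                 ≡⟨ eval-erase w σ c ⟩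
    coeff c σ *ℚ w σ +ℚ eval w (erase σ c)   ≡⟨ cong₂ (λ x y → x *ℚ w σ +ℚ y) (c₀ σ)
      (go N (erase σ c) shorter (λ τ → coeff-erase σ c τ (c₀ τ))) ⟩
    0ℚ *ℚ w σ +ℚ 0ℚ                          ≡⟨ cong (_+ℚ 0ℚ) (ℚₚ.*-zeroˡ (w σ)) ⟩
    0ℚ ∎
    where
    open ≡-Reasoning
    shorter : length (erase σ c) ≤ N
    shorter with σ ≟σ σ
    ... | yes _ = ℕₚ.≤-trans (length-erase σ c′) len
    ... | no σ≢σ = contradiction refl σ≢σ

point : Simplex m → Cochain m
point τ σ with σ ≟σ τ
... | yes _ = 1ℚ
... | no  _ = 0ℚ

coeff≡eval : ∀ (c : Chain m) τ → coeff c τ ≡ eval (point τ) c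
coeff≡eval [] τ = refl
coeff≡eval ((a , σ) ∷ c) τ with σ ≟σ τ
... | yes _ = cong₂ _+ℚ_ (sym (ℚₚ.*-identityʳ a)) (coeff≡eval c τ)
... | no  _ = trans (coeff≡eval c τ) (trans (sym (ℚₚ.+-identityˡ (eval (point τ) c)))
                (cong (_+ℚ eval (point τ) c) (sym (ℚₚ.*-zeroʳ a))))

-- The previous lemma applied to the difference `c ⊖ d`. This turns a coefficientwise identity into
-- one that can be tested against any cochain.
coeff≡⇒eval≡ : ∀ (c d : Chain m) → (∀ τ → coeff c τ ≡ coeff d τ) → ∀ w → eval w c ≡ eval w d
coeff≡⇒eval≡ c d e w = begin
  eval w c                                 ≡⟨ solve 2 (λ x y → x := x :- y :+ y) refl (eval w c) (eval w d) ⟩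
  eval w c - eval w d +ℚ eval w d          ≡⟨ cong (_+ℚ eval w d) (eval-⊖ w c d) ⟨
  eval w (c ⊖ d) +ℚ eval w d               ≡⟨ cong (_+ℚ eval w d) (coeff≡0⇒eval≡0 w (c ⊖ d) vanishes) ⟩
  0ℚ +ℚ eval w d                           ≡⟨ ℚₚ.+-identityˡ (eval w d) ⟩
  eval w d ∎
  where
  open ≡-Reasoning
  vanishes : ∀ τ → coeff (c ⊖ d) τ ≡ 0ℚ
  vanishes τ = begin
    coeff (c ⊖ d) τ                            ≡⟨ coeff≡eval (c ⊖ d) τ ⟩
    eval (point τ) (c ⊖ d)                     ≡⟨ eval-⊖ (point τ) c d ⟩
    eval (point τ) c - eval (point τ) d        ≡⟨ cong (λ x → x - eval (point τ) d)
      (trans (sym (coeff≡eval c τ)) (trans (e τ) (coeff≡eval d τ))) ⟩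
    eval (point τ) d - eval (point τ) d        ≡⟨ ℚₚ.+-inverseʳ (eval (point τ) d) ⟩
    0ℚ ∎

-- Sorting words by exterior products.

<ˡ-irrefl : {A : Subset m} → ¬ (A <ˡ A)
<ˡ-irrefl (there p) = <ˡ-irrefl p

<ˡ-trans : {A B C : Subset m} → A <ˡ B → B <ˡ C → A <ˡ C
<ˡ-trans here (there _) = here
<ˡ-trans (there _) here = here
<ˡ-trans (there p) (there q) = there (<ˡ-trans p q)

<ˡ-asym : {A B : Subset m} → A <ˡ B → ¬ (B <ˡ A)
<ˡ-asym p q = <ˡ-irrefl (<ˡ-trans p q)

tri-there : ∀ {b} {A B : Subset m} → Tri (A <ˡ B) (A ≡ B) (B <ˡ A) →
            Tri ((b ∷ A) <ˡ (b ∷ B)) (b ∷ A ≡ b ∷ B) ((b ∷ B) <ˡ (b ∷ A))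
tri-there (tri< p _ _) = tri< (there p) (λ { refl → <ˡ-irrefl p }) (λ { (there q) → <ˡ-asym p q })
tri-there (tri≈ _ refl _) = tri≈ <ˡ-irrefl refl <ˡ-irrefl
tri-there (tri> _ _ p) = tri> (λ { (there q) → <ˡ-asym p q }) (λ { refl → <ˡ-irrefl p }) (there p)

<ˡ-cmp : Trichotomous _≡_ (_<ˡ_ {m})
<ˡ-cmp [] [] = tri≈ (λ ()) refl (λ ())
<ˡ-cmp (false ∷ A) (true ∷ B) = tri< here (λ ()) (λ ())
<ˡ-cmp (true ∷ A) (false ∷ B) = tri> (λ ()) (λ ()) here
<ˡ-cmp (false ∷ A) (false ∷ B) = tri-there (<ˡ-cmp A B)
<ˡ-cmp (true ∷ A) (true ∷ B) = tri-there (<ˡ-cmp A B)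

Sorted : Simplex m → Set
Sorted = AllPairs _<ˡ_

-- The cases of v ∧ u ∧ σ, with `rest` standing for v ∧ σ: already in order, a repeated factor
-- giving zero, a transposition giving a sign. The comparison is an argument so that `insert`
-- reduces under a `with` on it.
place : (v u : Subset m) → Simplex m → Chain m → Tri (v <ˡ u) (v ≡ u) (u <ˡ v) → Chain m
place v u σ rest (tri< _ _ _) = (1ℚ , v ∷ u ∷ σ) ∷ []
place v u σ rest (tri≈ _ _ _) = []
place v u σ rest (tri> _ _ _) = negCons u rest

-- insert v σ is the exterior product v ∧ σ.
insert : Subset m → Simplex m → Chain m
insert v [] = (1ℚ , v ∷ []) ∷ []
insert v (u ∷ σ) = place v u σ (insert v σ) (<ˡ-cmp v u)

-- The alternation v₀ ∧ … ∧ v_q of a word, which may be unsorted or have repetitions.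
sort : Simplex m → Chain m
sort [] = (1ℚ , []) ∷ []
sort (v ∷ σ) = ext (insert v) (sort σ)

eval-single : ∀ (w : Cochain m) σ → eval w ((1ℚ , σ) ∷ []) ≡ w σ
eval-single w σ = trans (ℚₚ.+-identityʳ (1ℚ *ℚ w σ)) (ℚₚ.*-identityˡ (w σ))

eval-insert-head : ∀ (w : Cochain m) {v σ} → All (v <ˡ_) σ → eval w (insert v σ) ≡ w (v ∷ σ)
eval-insert-head w {v} [] = eval-single w (v ∷ [])
eval-insert-head w {v} {u ∷ σ} (v<u ∷ _) with <ˡ-cmp v u
... | tri< _ _ _ = eval-single w (v ∷ u ∷ σ)
... | tri≈ v≮u _ _ = contradiction v<u v≮u
... | tri> v≮u _ _ = contradiction v<u v≮u

AllTerms-insert : ∀ {P : Subset m → Set} {v σ} → P v → All P σ → AllTerms (All P) (insert v σ)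
AllTerms-insert Pv [] = (Pv ∷ []) ∷ []
AllTerms-insert {v = v} {u ∷ σ} Pv (Pu ∷ Pσ) with <ˡ-cmp v u
... | tri< _ _ _ = (Pv ∷ Pu ∷ Pσ) ∷ []
... | tri≈ _ _ _ = []
... | tri> _ _ _ = AllTerms-negCons (Pu ∷_) (AllTerms-insert Pv Pσ)

AllTerms-sort : ∀ {P : Subset m → Set} {σ} → All P σ → AllTerms (All P) (sort σ)
AllTerms-sort [] = [] ∷ []
AllTerms-sort (Pv ∷ Pσ) = AllTerms-ext (AllTerms-insert Pv) (AllTerms-sort Pσ)

insert-length : ∀ (v : Subset m) σ → AllTerms (λ τ → length τ ≡ suc (length σ)) (insert v σ)
insert-length v [] = refl ∷ []
insert-length v (u ∷ σ) with <ˡ-cmp v u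
... | tri< _ _ _ = refl ∷ []
... | tri≈ _ _ _ = []
... | tri> _ _ _ = AllTerms-negCons (cong suc) (insert-length v σ)

sort-length : ∀ (σ : Simplex m) → AllTerms (λ τ → length τ ≡ length σ) (sort σ)
sort-length [] = refl ∷ []
sort-length (v ∷ σ) = AllTerms-ext
  (λ {τ} e → subst (λ l → AllTerms (λ ρ → length ρ ≡ suc l) (insert v τ)) e (insert-length v τ))
  (sort-length σ)

insert-sorted : ∀ {v : Subset m} {σ} → Sorted σ → AllTerms Sorted (insert v σ)
insert-sorted [] = ([] ∷ []) ∷ []
insert-sorted {v = v} {u ∷ σ} (u<σ ∷ σ↗) with <ˡ-cmp v u
... | tri< v<u _ _ = ((v<u ∷ All.map (<ˡ-trans v<u) u<σ) ∷ u<σ ∷ σ↗) ∷ []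
... | tri≈ _ _ _ = []
-- Every vertex in a term of `insert v σ` is `v` or belongs to `σ`, hence lies above `u`.
... | tri> _ _ u<v = AllTerms-negCons (λ (p , q) → p ∷ q)
                       (All.zip (AllTerms-insert u<v u<σ , insert-sorted σ↗))

sort-sorted : ∀ (σ : Simplex m) → AllTerms Sorted (sort σ)
sort-sorted [] = [] ∷ []
sort-sorted (v ∷ σ) = AllTerms-ext insert-sorted (sort-sorted σ)

eval-sort-sorted : ∀ (w : Cochain m) {σ} → Sorted σ → eval w (sort σ) ≡ w σ
eval-sort-sorted w [] = eval-single w []
eval-sort-sorted w {v ∷ σ} (v<σ ∷ σ↗) = begin
  eval w (ext (insert v) (sort σ))              ≡⟨ eval-ext (insert v) w (sort σ) ⟩
  eval (λ τ → eval w (insert v τ)) (sort σ)     ≡⟨ eval-sort-sorted (λ τ → eval w (insert v τ)) σ↗ ⟩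
  eval w (insert v σ)                           ≡⟨ eval-insert-head w v<σ ⟩
  w (v ∷ σ) ∎
  where open ≡-Reasoning

-- ∂ (v ∧ σ) = σ - v ∧ ∂ σ
insert-∂ : ∀ (w : Cochain m) v {σ} → Sorted σ →
           eval (δ w) (insert v σ) ≡ w σ - δ (λ τ → eval w (insert v τ)) σ
insert-∂ w v [] = eval-single (δ w) (v ∷ [])
insert-∂ w v {u ∷ σ} (u<σ ∷ σ↗) with <ˡ-cmp v u
... | tri< v<u _ _ = begin
  eval (δ w) ((1ℚ , v ∷ u ∷ σ) ∷ [])                                    ≡⟨ eval-single (δ w) (v ∷ u ∷ σ) ⟩
  w (u ∷ σ) - (w (v ∷ σ) - δ (λ τ → w (v ∷ u ∷ τ)) σ)                   ≡⟨ -ℚ-congʳ (w (u ∷ σ)) (cong₂ _-_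
      (sym (eval-insert-head w (All.map (<ˡ-trans v<u) u<σ)))
      (δ-cong (λ τ → sym (eval-single w (v ∷ u ∷ τ))) σ)) ⟩
  w (u ∷ σ) - (eval w (insert v σ) - δ (λ τ → eval w ((1ℚ , v ∷ u ∷ τ) ∷ [])) σ) ∎
  where open ≡-Reasoning
-- Inserting `u` into the face `σ` gives back `u ∷ σ`, which cancels the first term; all other faces
-- still contain `u`, and inserting it again gives zero.
... | tri≈ _ refl _ = begin
  0ℚ                                                ≡⟨ solve 1 (λ x → con 0ℚ := x :- (x :- con 0ℚ)) refl (w (u ∷ σ)) ⟩
  w (u ∷ σ) - (w (u ∷ σ) - 0ℚ)                      ≡⟨ -ℚ-congʳ (w (u ∷ σ)) (cong₂ _-_ (sym (eval-insert-head w u<σ)) (sym (δ-0 σ))) ⟩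
  w (u ∷ σ) - (eval w (insert u σ) - δ (λ _ → 0ℚ) σ) ∎
  where open ≡-Reasoning
... | tri> _ _ _ = begin
  eval (δ w) (negCons u (insert v σ))               ≡⟨ eval-negCons (δ w) u (insert v σ) ⟩
  - eval (λ τ → w τ - δ wᵤ τ) (insert v σ)          ≡⟨ cong -_ (eval-sub w (δ wᵤ) (insert v σ)) ⟩
  - (eval w (insert v σ) - eval (δ wᵤ) (insert v σ)) ≡⟨ cong (λ x → - (eval w (insert v σ) - x)) (insert-∂ wᵤ v σ↗) ⟩
  - (eval w (insert v σ) - (wᵤ σ - δ (λ τ → eval wᵤ (insert v τ)) σ))
    ≡⟨ solve 3 (λ x y z → :- (x :- (y :- z)) := y :- (x :- :- z)) refl
         (eval w (insert v σ)) (wᵤ σ) (δ (λ τ → eval wᵤ (insert v τ)) σ) ⟩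
  wᵤ σ - (eval w (insert v σ) - - δ (λ τ → eval wᵤ (insert v τ)) σ)
    ≡⟨ cong (λ x → wᵤ σ - (eval w (insert v σ) - x))
         (trans (sym (δ-neg (λ τ → eval wᵤ (insert v τ)) σ))
                (δ-cong (λ τ → sym (eval-negCons w u (insert v τ))) σ)) ⟩
  wᵤ σ - (eval w (insert v σ) - δ (λ τ → eval w (negCons u (insert v τ))) σ) ∎
  where
  open ≡-Reasoning
  wᵤ : Cochain _
  wᵤ τ = w (u ∷ τ)

-- Alternation is a chain map from words to sorted words. The formula for the boundary of v ∧ τ is
-- needed only at terms τ of `sort σ`, which are sorted; the induction hypothesis is used for the
-- cochain `wᵥ`.
sort-∂ : ∀ (w : Cochain m) σ → eval (δ w) (sort σ) ≡ δ (λ τ → eval w (sort τ)) σ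
sort-∂ w [] = refl
sort-∂ w (v ∷ σ) = begin
  eval (δ w) (ext (insert v) (sort σ))                  ≡⟨ eval-ext (insert v) (δ w) (sort σ) ⟩
  eval (λ τ → eval (δ w) (insert v τ)) (sort σ)         ≡⟨ eval-cong-on (insert-∂ w v) (sort-sorted σ) ⟩
  eval (λ τ → w τ - δ wᵥ τ) (sort σ)                    ≡⟨ eval-sub w (δ wᵥ) (sort σ) ⟩
  eval w (sort σ) - eval (δ wᵥ) (sort σ)                ≡⟨ -ℚ-congʳ (eval w (sort σ)) (sort-∂ wᵥ σ) ⟩
  eval w (sort σ) - δ (λ τ → eval wᵥ (sort τ)) σ        ≡⟨ -ℚ-congʳ (eval w (sort σ))
                                                             (δ-cong (λ τ → sym (eval-ext (insert v) w (sort τ))) σ) ⟩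
  eval w (sort σ) - δ (λ τ → eval w (sort (v ∷ τ))) σ ∎
  where
  open ≡-Reasoning
  wᵥ : Cochain _
  wᵥ τ = eval w (insert v τ)

module _ {g : Subset m → Subset k} (mono : ∀ {A B} → A <ˡ B → g A <ˡ g B) where

  -- A strictly increasing map preserves the outcome of each comparison made by `insert`, so the
  -- mixed cases are contradictory.
  insert-map : ∀ w v σ → eval w (insert (g v) (map g σ)) ≡ eval (w ∘ map g) (insert v σ)
  insert-map w v [] = refl
  insert-map w v (u ∷ σ) with <ˡ-cmp v u | <ˡ-cmp (g v) (g u)
  ... | tri< _ _ _ | tri< _ _ _ = refl
  ... | tri< v<u _ _ | tri≈ ≮ _ _ = contradiction (mono v<u) ≮
  ... | tri< v<u _ _ | tri> ≮ _ _ = contradiction (mono v<u) ≮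
  ... | tri≈ _ refl _ | tri< _ ≢ _ = contradiction refl ≢
  ... | tri≈ _ _ _ | tri≈ _ _ _ = refl
  ... | tri≈ _ refl _ | tri> _ ≢ _ = contradiction refl ≢
  ... | tri> _ _ u<v | tri< _ _ ≯ = contradiction (mono u<v) ≯
  ... | tri> _ _ u<v | tri≈ _ _ ≯ = contradiction (mono u<v) ≯
  ... | tri> _ _ _ | tri> _ _ _ = begin
    eval w (negCons (g u) (insert (g v) (map g σ)))       ≡⟨ eval-negCons w (g u) (insert (g v) (map g σ)) ⟩
    - eval (λ τ → w (g u ∷ τ)) (insert (g v) (map g σ))   ≡⟨ cong -_ (insert-map (λ τ → w (g u ∷ τ)) v σ) ⟩
    - eval (λ τ → w (map g (u ∷ τ))) (insert v σ)         ≡⟨ eval-negCons (w ∘ map g) u (insert v σ) ⟨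
    eval (w ∘ map g) (negCons u (insert v σ)) ∎
    where open ≡-Reasoning

  sort-map : ∀ w σ → eval w (sort (map g σ)) ≡ eval (w ∘ map g) (sort σ)
  sort-map w [] = refl
  sort-map w (v ∷ σ) = begin
    eval w (ext (insert (g v)) (sort (map g σ)))              ≡⟨ eval-ext (insert (g v)) w (sort (map g σ)) ⟩
    eval (λ τ → eval w (insert (g v) τ)) (sort (map g σ))     ≡⟨ sort-map (λ τ → eval w (insert (g v) τ)) σ ⟩
    eval (λ τ → eval w (insert (g v) (map g τ))) (sort σ)     ≡⟨ eval-cong (insert-map w v) (sort σ) ⟩
    eval (λ τ → eval (w ∘ map g) (insert v τ)) (sort σ)       ≡⟨ eval-ext (insert v) (w ∘ map g) (sort σ) ⟨
    eval (w ∘ map g) (ext (insert v) (sort σ)) ∎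
    where open ≡-Reasoning

-- The prism homotopy.

-- The homotopy between the chain maps induced by h and g:
-- Σᵢ (-1)ⁱ [h v₀, …, h vᵢ, g vᵢ, …, g v_q].
module _ (h g : Subset m → Subset k) where

  prism : Simplex m → Chain k
  prism [] = []
  prism (v ∷ σ) = (1ℚ , h v ∷ g v ∷ map g σ) ∷ negCons (h v) (prism σ)

  eval-prism : ∀ w v σ → eval w (prism (v ∷ σ)) ≡
               w (h v ∷ g v ∷ map g σ) - eval (λ τ → w (h v ∷ τ)) (prism σ)
  eval-prism w v σ = cong₂ _+ℚ_ (ℚₚ.*-identityˡ (w (h v ∷ g v ∷ map g σ))) (eval-negCons w (h v) (prism σ))

  prism-∂ : ∀ w σ → eval (δ w) (prism σ) ≡
            w (map g σ) - w (map h σ) - δ (λ τ → eval w (prism τ)) σ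
  prism-∂ w [] = solve 1 (λ x → con 0ℚ := x :- x :- con 0ℚ) refl (w [])
  prism-∂ w (v ∷ σ) = begin
    eval (δ w) (prism (v ∷ σ))
      ≡⟨ eval-prism (δ w) v σ ⟩
    a - (b - c) - eval (λ τ → w τ - δ w′ τ) (prism σ)
      ≡⟨ -ℚ-congʳ (a - (b - c)) (trans (eval-sub w (δ w′) (prism σ)) (-ℚ-congʳ (e) (prism-∂ w′ σ))) ⟩
    a - (b - c) - (e - (b - d - f))
      -- The word behind `b` is `h v ∷ map g σ`. It arises by deleting `g v` from the leading term
      -- and again as the end of the prism on `σ`, with opposite signs.
      ≡⟨ solve 6 (λ a b c d e f → a :- (b :- c) :- (e :- (b :- d :- f)) := a :- d :- (e :- (c :- f)))
           refl a b c d e f ⟩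
    a - d - (e - (c - f))
      ≡⟨ cong (λ x → a - d - (e - x)) (trans
           (cong (λ x → x - f) (δ-map g (λ τ → w (h v ∷ g v ∷ τ)) σ))
           (trans (sym (δ-sub (λ τ → w (h v ∷ g v ∷ map g τ)) (λ τ → eval w′ (prism τ)) σ))
                  (δ-cong (λ τ → sym (eval-prism w v τ)) σ))) ⟩
    w (map g (v ∷ σ)) - w (map h (v ∷ σ)) - δ (λ τ → eval w (prism τ)) (v ∷ σ) ∎
    where
    open ≡-Reasoning
    w′ : Cochain k
    w′ τ = w (h v ∷ τ)
    a = w (map g (v ∷ σ))
    b = w′ (map g σ)
    c = δ (λ τ → w (h v ∷ g v ∷ τ)) (map g σ)
    d = w (map h (v ∷ σ))
    e = eval w (prism σ)
    f = δ (λ τ → eval w′ (prism τ)) σ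

-- Simplices as families of pairwise meeting sets.

-- For n-sets, |A △ B| = 2n - 2|A ∩ B|, so distance at most 2(n-1) means a common point. Unlike
-- distance, this is visibly preserved by maps of ground sets.
Meets : Subset m → Subset m → Set
Meets A B = ∃ λ i → i ∈ A × i ∈ B

Meets-sym : {A B : Subset m} → Meets A B → Meets B A
Meets-sym (i , i∈A , i∈B) = i , i∈B , i∈A

dist-≤ : (A B : Subset m) → dist A B ≤ ∣ A ∣ + ∣ B ∣
dist-≤ [] [] = z≤n
dist-≤ (true ∷ A) (true ∷ B) = ℕₚ.≤-trans (dist-≤ A B)
  (ℕₚ.+-mono-≤ (ℕₚ.n≤1+n ∣ A ∣) (ℕₚ.n≤1+n ∣ B ∣))
dist-≤ (true ∷ A) (false ∷ B) = s≤s (dist-≤ A B)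
dist-≤ (false ∷ A) (true ∷ B) = subst (suc (dist A B) ≤_) (sym (ℕₚ.+-suc ∣ A ∣ ∣ B ∣)) (s≤s (dist-≤ A B))
dist-≤ (false ∷ A) (false ∷ B) = dist-≤ A B

Meets⇒dist : (A B : Subset m) → Meets A B → 2 + dist A B ≤ ∣ A ∣ + ∣ B ∣
Meets⇒dist (true ∷ A) (true ∷ B) (zero , _) =
  s≤s (subst (suc (dist A B) ≤_) (sym (ℕₚ.+-suc ∣ A ∣ ∣ B ∣)) (s≤s (dist-≤ A B)))
Meets⇒dist (true ∷ A) (true ∷ B) (suc i , there p , there q) = ℕₚ.≤-trans (Meets⇒dist A B (i , p , q))
  (ℕₚ.+-mono-≤ (ℕₚ.n≤1+n ∣ A ∣) (ℕₚ.n≤1+n ∣ B ∣))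
Meets⇒dist (true ∷ A) (false ∷ B) (suc i , there p , there q) = s≤s (Meets⇒dist A B (i , p , q))
Meets⇒dist (false ∷ A) (true ∷ B) (suc i , there p , there q) =
  subst (3 + dist A B ≤_) (sym (ℕₚ.+-suc ∣ A ∣ ∣ B ∣)) (s≤s (Meets⇒dist A B (i , p , q)))
Meets⇒dist (false ∷ A) (false ∷ B) (suc i , there p , there q) = Meets⇒dist A B (i , p , q)

dist⇒Meets : (A B : Subset m) → dist A B < ∣ A ∣ + ∣ B ∣ → Meets A B
dist⇒Meets [] [] ()
dist⇒Meets (true ∷ A) (true ∷ B) _ = zero , here , here
dist⇒Meets (true ∷ A) (false ∷ B) (s≤s d<) with dist⇒Meets A B d<
... | i , p , q = suc i , there p , there q
dist⇒Meets (false ∷ A) (true ∷ B) d<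
  with s≤s d<′ ← subst (2 + dist A B ≤_) (ℕₚ.+-suc ∣ A ∣ ∣ B ∣) d< with dist⇒Meets A B d<′
... | i , p , q = suc i , there p , there q
dist⇒Meets (false ∷ A) (false ∷ B) d< with dist⇒Meets A B d<
... | i , p , q = suc i , there p , there q

dist-self : (A : Subset m) → dist A A ≡ 0
dist-self [] = refl
dist-self (true ∷ A) = dist-self A
dist-self (false ∷ A) = dist-self A

-- Quantifying over members makes this insensitive to order and repetition, so it applies to
-- unsorted words. The case of equal members asks for a nonempty set, which n ≥ 1 provides.
Clique : ℕ → Simplex m → Set
Clique n σ = All (λ A → ∣ A ∣ ≡ n) σ × (∀ {A B} → A ∈ₗ σ → B ∈ₗ σ → Meets A B)

Word : ℕ → ℕ → Simplex m → Set
Word n q σ = length σ ≡ suc q × Clique n σ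

SortedWord : ℕ → ℕ → Simplex m → Set
SortedWord n q σ = Word n q σ × Sorted σ

n+n≡2*n : ∀ n → n + n ≡ 2 * n
n+n≡2*n n = cong (n +_) (sym (ℕₚ.+-identityʳ n))

IsSimplex⇒SortedWord : ∀ {σ : Simplex m} → 1 ≤ n → IsSimplex m n (2 * (n ∸ 1)) q σ → SortedWord n q σ
IsSimplex⇒SortedWord {n = n@(suc n′)} _ (len , sizes , pairs) =
  (len , sizes , meets sizes pairs) , AllPairs.map proj₁ pairs
  where
  close : ∀ {A B : Subset _} → ∣ A ∣ ≡ n → ∣ B ∣ ≡ n → dist A B ≤ 2 * n′ → Meets A B
  close {A} {B} a b d = dist⇒Meets A B (begin-strict
    dist A B         ≤⟨ d ⟩
    2 * n′           ≡⟨ n+n≡2*n n′ ⟨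
    n′ + n′          <⟨ ℕₚ.+-mono-< (ℕₚ.n<1+n n′) (ℕₚ.n<1+n n′) ⟩
    n + n            ≡⟨ cong₂ _+_ a b ⟨
    ∣ A ∣ + ∣ B ∣ ∎)
    where open ℕₚ.≤-Reasoning
  meets : ∀ {σ} → All (λ A → ∣ A ∣ ≡ n) σ → AllPairs (λ A B → A <ˡ B × dist A B ≤ 2 * n′) σ →
          ∀ {A B} → A ∈ₗ σ → B ∈ₗ σ → Meets A B
  meets (a ∷ _) _ {A} (here refl) (here refl) = close a a (subst (_≤ 2 * n′) (sym (dist-self A)) z≤n)
  meets (a ∷ as) (p ∷ _) (here refl) (there B∈) = close a (All.lookup as B∈) (proj₂ (All.lookup p B∈))
  meets (a ∷ as) (p ∷ _) (there A∈) (here refl) =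
    Meets-sym (close a (All.lookup as A∈) (proj₂ (All.lookup p A∈)))
  meets (_ ∷ as) (_ ∷ ps) (there A∈) (there B∈) = meets as ps A∈ B∈

SortedWord⇒IsSimplex : ∀ {σ : Simplex m} → 1 ≤ n → SortedWord n q σ → IsSimplex m n (2 * (n ∸ 1)) q σ
SortedWord⇒IsSimplex {n = suc n′} _ ((len , sizes , meets) , σ↗) = len , sizes , pairs sizes meets σ↗
  where
  close : ∀ {A B : Subset _} → ∣ A ∣ ≡ suc n′ → ∣ B ∣ ≡ suc n′ → Meets A B → dist A B ≤ 2 * n′
  close {A} {B} a b p = ℕₚ.+-cancelˡ-≤ 2 (dist A B) (2 * n′) (begin
    2 + dist A B          ≤⟨ Meets⇒dist A B p ⟩
    ∣ A ∣ + ∣ B ∣         ≡⟨ cong₂ _+_ a b ⟩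
    suc n′ + suc n′       ≡⟨ cong suc (ℕₚ.+-suc n′ n′) ⟩
    2 + (n′ + n′)         ≡⟨ cong (2 +_) (n+n≡2*n n′) ⟩
    2 + 2 * n′ ∎)
    where open ℕₚ.≤-Reasoning
  pairs : ∀ {σ} → All (λ A → ∣ A ∣ ≡ suc n′) σ → (∀ {A B} → A ∈ₗ σ → B ∈ₗ σ → Meets A B) → Sorted σ →
          AllPairs (λ A B → A <ˡ B × dist A B ≤ 2 * n′) σ
  pairs [] _ [] = []
  pairs (a ∷ as) meets (v<σ ∷ σ↗) =
    All.tabulate (λ B∈ → All.lookup v<σ B∈ , close a (All.lookup as B∈) (meets (here refl) (there B∈)))
    ∷ pairs as (λ A∈ B∈ → meets (there A∈) (there B∈)) σ↗

-- Vertex maps carrying a map of ground sets.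

⊆∧∣∣≡⇒≡ : {A B : Subset m} → (∀ {i} → i ∈ A → i ∈ B) → ∣ A ∣ ≡ ∣ B ∣ → A ≡ B
⊆∧∣∣≡⇒≡ {A = []} {[]} _ _ = refl
⊆∧∣∣≡⇒≡ {A = true ∷ A} {true ∷ B} A⊆B e =
  cong (true ∷_) (⊆∧∣∣≡⇒≡ (λ p → Subsetₚ.drop-there (A⊆B (there p))) (ℕₚ.suc-injective e))
⊆∧∣∣≡⇒≡ {A = true ∷ A} {false ∷ B} A⊆B _ with () ← A⊆B here
⊆∧∣∣≡⇒≡ {A = false ∷ A} {true ∷ B} A⊆B e = contradiction
  (Subsetₚ.p⊆q⇒∣p∣≤∣q∣ {p = A} {q = B} (λ p → Subsetₚ.drop-there (A⊆B (there p))))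
  (ℕₚ.<⇒≱ (ℕₚ.≤-reflexive (sym e)))
⊆∧∣∣≡⇒≡ {A = false ∷ A} {false ∷ B} A⊆B e =
  cong (false ∷_) (⊆∧∣∣≡⇒≡ (λ p → Subsetₚ.drop-there (A⊆B (there p))) e)

image : (Fin m → Fin k) → Subset m → Subset k
image f [] = ⊥
image f (true ∷ A) = ⁅ f zero ⁆ ∪ image (f ∘ suc) A
image f (false ∷ A) = image (f ∘ suc) A

∈-image : ∀ (f : Fin m → Fin k) {A i} → i ∈ A → f i ∈ image f A
∈-image f {true ∷ A} here = Subsetₚ.x∈p∪q⁺ (inj₁ (Subsetₚ.x∈⁅x⁆ (f zero)))
∈-image f {true ∷ A} (there p) = Subsetₚ.x∈p∪q⁺ (inj₂ (∈-image (f ∘ suc) p))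
∈-image f {false ∷ A} (there p) = ∈-image (f ∘ suc) p

∣∪∣≤ : (A B : Subset m) → ∣ A ∪ B ∣ ≤ ∣ A ∣ + ∣ B ∣
∣∪∣≤ [] [] = z≤n
∣∪∣≤ (true ∷ A) (true ∷ B) = s≤s (ℕₚ.≤-trans (∣∪∣≤ A B) (ℕₚ.+-monoʳ-≤ ∣ A ∣ (ℕₚ.n≤1+n ∣ B ∣)))
∣∪∣≤ (true ∷ A) (false ∷ B) = s≤s (∣∪∣≤ A B)
∣∪∣≤ (false ∷ A) (true ∷ B) = subst (suc ∣ A ∪ B ∣ ≤_) (sym (ℕₚ.+-suc ∣ A ∣ ∣ B ∣)) (s≤s (∣∪∣≤ A B))
∣∪∣≤ (false ∷ A) (false ∷ B) = ∣∪∣≤ A B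

∣image∣≤ : ∀ (f : Fin m → Fin k) A → ∣ image f A ∣ ≤ ∣ A ∣
∣image∣≤ {k = k} f [] = ℕₚ.≤-reflexive (Subsetₚ.∣⊥∣≡0 k)
∣image∣≤ f (true ∷ A) = ℕₚ.≤-trans (∣∪∣≤ ⁅ f zero ⁆ (image (f ∘ suc) A))
  (ℕₚ.+-mono-≤ (ℕₚ.≤-reflexive (Subsetₚ.∣⁅x⁆∣≡1 (f zero))) (∣image∣≤ (f ∘ suc) A))
∣image∣≤ f (false ∷ A) = ∣image∣≤ (f ∘ suc) A

-- The number counts the elements still to be placed, and points are added greedily from the front.
-- Which points are added is immaterial, since all choices are contiguous.
pad : ℕ → Subset m → Subset m
pad n [] = []
pad n (true ∷ A) = true ∷ pad (n ∸ 1) A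
pad n (false ∷ A) with ∣ A ∣ ℕₚ.<? n
... | yes _ = true ∷ pad (n ∸ 1) A
... | no  _ = false ∷ pad n A

pad-⊇ : ∀ n {A : Subset m} {i} → i ∈ A → i ∈ pad n A
pad-⊇ n {true ∷ A} here = here
pad-⊇ n {true ∷ A} (there p) = there (pad-⊇ (n ∸ 1) p)
pad-⊇ n {false ∷ A} (there p) with ∣ A ∣ ℕₚ.<? n
... | yes _ = there (pad-⊇ (n ∸ 1) p)
... | no  _ = there (pad-⊇ n p)

∣pad∣ : ∀ n (A : Subset m) → ∣ A ∣ ≤ n → n ≤ m → ∣ pad n A ∣ ≡ n
∣pad∣ zero [] _ _ = refl
∣pad∣ (suc n) (true ∷ A) (s≤s p) (s≤s q) = cong suc (∣pad∣ n A p q)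
∣pad∣ {suc m} n (false ∷ A) p q with ∣ A ∣ ℕₚ.<? n
∣pad∣ {suc m} (suc n) (false ∷ A) p (s≤s q) | yes (s≤s r) = cong suc (∣pad∣ n A r q)
-- Here `A` already has at least n elements, so its ground set, one point smaller, is still large
-- enough.
... | no ≮ = ∣pad∣ n A p (ℕₚ.≤-trans (ℕₚ.≮⇒≥ ≮) (Subsetₚ.∣p∣≤n A))

-- On vertices a map f of ground sets only determines where the intersections
-- go; every g carrying f preserves the relation of meeting.
Carries : ℕ → (Fin m → Fin k) → (Subset m → Subset k) → Set
Carries n f g = ∀ {A} → ∣ A ∣ ≡ n → ∣ g A ∣ ≡ n × (∀ {i} → i ∈ A → f i ∈ g A)

vertexMap : ℕ → (Fin m → Fin k) → Subset m → Subset k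
vertexMap n f A = pad n (image f A)

vertexMap-carries : n ≤ k → (f : Fin m → Fin k) → Carries n f (vertexMap n f)
vertexMap-carries {n = n} n≤k f {A} e =
  ∣pad∣ n (image f A) (subst (∣ image f A ∣ ≤_) e (∣image∣≤ f A)) n≤k ,
  λ i∈A → pad-⊇ n (∈-image f i∈A)

Carries-∘ : ∀ {f : Fin m → Fin k} {g} {f′ : Fin k → Fin ℓ} {g′} →
            Carries n f′ g′ → Carries n f g → Carries n (f′ ∘ f) (g′ ∘ g)
Carries-∘ c′ c e with c e
... | e′ , ∈g with c′ e′
... | e″ , ∈g′ = e″ , ∈g′ ∘ ∈g

Carries-cong : ∀ {f f′ : Fin m → Fin k} {g} → (∀ i → f i ≡ f′ i) → Carries n f g → Carries n f′ g
Carries-cong {g = g} f≗f′ c {A} e = proj₁ (c e) , λ {i} i∈A → subst (_∈ g A) (f≗f′ i) (proj₂ (c e) i∈A)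

module _ (n : ℕ) (f : Fin m → Fin k) where

  CarriedFrom : Simplex m → Subset k → Set
  CarriedFrom σ B = ∣ B ∣ ≡ n × ∃ λ A → A ∈ₗ σ × (∀ {i} → i ∈ A → f i ∈ B)

  -- Two carried sets contain `f i` for any common point `i` of their sources, whichever vertex maps
  -- produced them. Hence words mixing values of two maps that carry `f` are cliques, which is
  -- contiguity.
  CarriedFrom-clique : ∀ {σ τ} → Clique n σ → All (CarriedFrom σ) τ → Clique n τ
  CarriedFrom-clique (_ , meets) carried = All.map proj₁ carried , λ B∈ B′∈ →
    let _ , A , A∈ , A→B = All.lookup carried B∈
        _ , A′ , A′∈ , A′→B′ = All.lookup carried B′∈
        i , i∈A , i∈A′ = meets A∈ A′∈
    in f i , A→B i∈A , A′→B′ i∈A′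

  module _ {g} (c : Carries n f g) where

    vertex-carried : ∀ {σ} → All (λ A → ∣ A ∣ ≡ n) σ → All (λ A → CarriedFrom σ (g A)) σ
    vertex-carried sizes =
      All.tabulate (λ {A} A∈ → let e = All.lookup sizes A∈ in proj₁ (c e) , A , A∈ , proj₂ (c e))

    map-carried : ∀ {σ} → All (λ A → ∣ A ∣ ≡ n) σ → All (CarriedFrom σ) (map g σ)
    map-carried sizes = Allₚ.map⁺ (vertex-carried sizes)

sort-word : ∀ {σ : Simplex m} → Word n q σ → AllTerms (SortedWord n q) (sort σ)
sort-word {n = n} {σ = σ} (len , clique@(sizes , meets)) =
  All.zipWith (λ ((l , c) , s) → (trans l len , CarriedFrom-clique n (λ i → i) clique c) , s)
    (All.zip (sort-length σ , AllTerms-sort carried) ,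
     sort-sorted σ)
  where
  carried : All (CarriedFrom n (λ i → i) σ) σ
  carried = All.tabulate (λ {A} A∈ → All.lookup sizes A∈ , A , A∈ , λ {i} i∈A → i∈A)

map-word : ∀ {f : Fin m → Fin k} {g} → Carries n f g → ∀ {σ} → Word n q σ → Word n q (map g σ)
map-word {n = n} {f = f} {g} c {σ} (len , clique) =
  trans (Listₚ.length-map g σ) len , CarriedFrom-clique n f clique (map-carried n f c (proj₁ clique))

prism-word : ∀ {f : Fin m → Fin k} {h g} → Carries n f h → Carries n f g →
             ∀ {σ} → Word n q σ → AllTerms (Word n (suc q)) (prism h g σ)
prism-word {n = n} {f = f} {h} {g} ch cg {σ} (len , clique@(sizes , _)) =
  All.map (λ (l , c) → trans l (cong suc len) , CarriedFrom-clique n f clique c)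
    (go (vertex-carried n f ch sizes) (vertex-carried n f cg sizes))
  where
  -- The recursion shortens the word to a tail `τ`, while the carriers remain in the whole clique
  -- `σ`.
  go : ∀ {τ} → All (CarriedFrom n f σ ∘ h) τ → All (CarriedFrom n f σ ∘ g) τ →
       AllTerms (λ ρ → length ρ ≡ suc (length τ) × All (CarriedFrom n f σ) ρ) (prism h g τ)
  go [] [] = []
  go {_ ∷ τ} (p ∷ ps) (r ∷ rs) =
    (cong (λ l → suc (suc l)) (Listₚ.length-map g τ) , p ∷ r ∷ Allₚ.map⁺ rs) ∷
    AllTerms-negCons (λ (l , c) → cong suc l , p ∷ c) (go ps rs)

-- Cycles and boundaries tested by cochains.

Cycle : ℕ → ℕ → Chain m → Set
Cycle n q c = AllTerms (SortedWord n q) c × (∀ w → eval (δ w) c ≡ 0ℚ)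

record Boundary (n q : ℕ) {m} (c : Chain m) : Set where
  constructor filling
  field
    chain : Chain m
    words : AllTerms (SortedWord n (suc q)) chain
    ∂-chain : ∀ w → eval (δ w) chain ≡ eval w c

IsCycle⇒Cycle : ∀ {c : Chain m} → 1 ≤ n → IsCycle m n (2 * (n ∸ 1)) q c → Cycle n q c
IsCycle⇒Cycle {c = c} 1≤n (simplices , ∂c≡0) = All.map (IsSimplex⇒SortedWord 1≤n) simplices ,
  λ w → trans (sym (eval-∂ w c)) (coeff≡0⇒eval≡0 w (∂ c) ∂c≡0)

Cycle⇒IsCycle : ∀ {c : Chain m} → 1 ≤ n → Cycle n q c → IsCycle m n (2 * (n ∸ 1)) q c
Cycle⇒IsCycle {c = c} 1≤n (words , δc≡0) = All.map (SortedWord⇒IsSimplex 1≤n) words ,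
  λ τ → trans (coeff≡eval (∂ c) τ) (trans (eval-∂ (point τ) c) (δc≡0 (point τ)))

IsBoundary⇒Boundary : ∀ {c : Chain m} → 1 ≤ n → IsBoundary m n (2 * (n ∸ 1)) q c → Boundary n q c
IsBoundary⇒Boundary {c = c} 1≤n (d , simplices , ∂d≡c) = filling d (All.map (IsSimplex⇒SortedWord 1≤n) simplices)
  (λ w → trans (sym (eval-∂ w d)) (coeff≡⇒eval≡ (∂ d) c ∂d≡c w))

Boundary⇒IsBoundary : ∀ {c : Chain m} → 1 ≤ n → Boundary n q c → IsBoundary m n (2 * (n ∸ 1)) q c
Boundary⇒IsBoundary {c = c} 1≤n (filling d words δd≡c) = d , All.map (SortedWord⇒IsSimplex 1≤n) words ,
  λ τ → trans (coeff≡eval (∂ d) τ) (trans (eval-∂ (point τ) d) (trans (δd≡c (point τ)) (sym (coeff≡eval c τ))))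

Boundary-cong : ∀ {c c′ : Chain m} → (∀ w → eval w c ≡ eval w c′) → Boundary n q c → Boundary n q c′
Boundary-cong e (filling d words δd≡c) = filling d words (λ w → trans (δd≡c w) (e w))

Boundary-scale : ∀ a {c : Chain m} → Boundary n q c → Boundary n q (scale a c)
Boundary-scale a {c} (filling d words δd≡c) = filling (scale a d) (AllTerms-scale a words)
  (λ w → trans (eval-scale (δ w) a d) (trans (cong (a *ℚ_) (δd≡c w)) (sym (eval-scale w a c))))

Boundary-++ : ∀ {c c′ : Chain m} → Boundary n q c → Boundary n q c′ → Boundary n q (c ++ c′)
Boundary-++ {c = c} {c′} (filling d words δd≡c) (filling d′ words′ δd′≡c′) =
  filling (d ++ d′) (Allₚ.++⁺ words words′)
  (λ w → trans (eval-++ (δ w) d d′) (trans (cong₂ _+ℚ_ (δd≡c w) (δd′≡c′ w)) (sym (eval-++ w c c′))))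

Boundary-[] : Boundary n q {m} []
Boundary-[] = filling [] [] (λ _ → refl)

Boundary-difference : ∀ {c c′ e : Chain m} → Boundary n q c → Boundary n q c′ →
                      (∀ w → eval w e ≡ eval w c - eval w c′) → Boundary n q e
Boundary-difference {c = c} {c′} b b′ e≡ = Boundary-cong (λ w → trans (eval-⊖ w c c′) (sym (e≡ w)))
  (Boundary-++ b (Boundary-scale (- 1ℚ) b′))

-- Induced chain maps and contiguity.

-- The simplicial chain map of `g`: `sort` discards degenerate images and supplies the orientation
-- signs.
push : (Subset m → Subset k) → Chain m → Chain k
push g = ext (λ σ → sort (map g σ))

eval-push : ∀ (g : Subset m → Subset k) w c → eval w (push g c) ≡ eval (λ σ → eval w (sort (map g σ))) c
eval-push g = eval-ext (λ σ → sort (map g σ))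

push-∂ : ∀ (g : Subset m → Subset k) w c →
         eval (δ w) (push g c) ≡ eval (δ (λ σ → eval w (sort (map g σ)))) c
push-∂ g w c = trans (eval-push g (δ w) c)
  (eval-cong (λ σ → trans (sort-∂ w (map g σ)) (δ-map g (λ τ → eval w (sort τ)) σ)) c)

module _ {f : Fin m → Fin k} {g} (c : Carries n f g) where

  push-words : ∀ {z} → AllTerms (SortedWord n q) z → AllTerms (SortedWord n q) (push g z)
  push-words = AllTerms-ext (λ (word , _) → sort-word (map-word c word))

  push-Cycle : ∀ {z} → Cycle n q z → Cycle n q (push g z)
  push-Cycle {z = z} (words , δz≡0) = push-words words , λ w → trans (push-∂ g w z) (δz≡0 _)

  push-Boundary : ∀ {z} → Boundary n q z → Boundary n q (push g z)
  push-Boundary {z = z} (filling d words δd≡z) = filling (push g d) (push-words words)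
    (λ w → trans (push-∂ g w d) (trans (δd≡z _) (sym (eval-push g w z))))

-- The sorted prism on `z` has boundary `push g z ⊖ push h z`, because the term involving the
-- boundary of `z` vanishes. It lies in the complex because `h` and `g` carry the same `f`.
push-contiguous : ∀ {f : Fin m → Fin k} {h g} → Carries n f h → Carries n f g →
                  ∀ {z} → Cycle n q z → Boundary n q (push g z) → Boundary n q (push h z)
push-contiguous {h = h} {g} ch cg {z} (words , δz≡0) b =
  Boundary-difference {c′ = push g z ⊖ push h z} b (filling Q Q-words δQ) λ w →
    trans (solve 2 (λ x y → y := x :- (x :- y)) refl (eval w (push g z)) (eval w (push h z)))
      (-ℚ-congʳ (eval w (push g z)) (sym (eval-⊖ w (push g z) (push h z))))
  where
  Q : Chain _
  Q = ext sort (ext (prism h g) z)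
  Q-words = AllTerms-ext sort-word (AllTerms-ext (λ (word , _) → prism-word ch cg word) words)
  δQ : ∀ w → eval (δ w) Q ≡ eval w (push g z ⊖ push h z)
  δQ w = begin
    eval (δ w) Q
      ≡⟨ eval-ext sort (δ w) (ext (prism h g) z) ⟩
    eval (λ τ → eval (δ w) (sort τ)) (ext (prism h g) z)
      ≡⟨ eval-cong (sort-∂ w) (ext (prism h g) z) ⟩
    eval (δ w̃) (ext (prism h g) z)
      ≡⟨ eval-ext (prism h g) (δ w̃) z ⟩
    eval (λ σ → eval (δ w̃) (prism h g σ)) z
      ≡⟨ eval-cong (prism-∂ h g w̃) z ⟩
    eval (λ σ → w̃ (map g σ) - w̃ (map h σ) - δ W σ) z
      ≡⟨ eval-sub (λ σ → w̃ (map g σ) - w̃ (map h σ)) (δ W) z ⟩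
    eval (λ σ → w̃ (map g σ) - w̃ (map h σ)) z - eval (δ W) z
      ≡⟨ cong₂ _-_ (eval-sub (w̃ ∘ map g) (w̃ ∘ map h) z) (δz≡0 W) ⟩
    eval (w̃ ∘ map g) z - eval (w̃ ∘ map h) z - 0ℚ
      ≡⟨ solve 2 (λ x y → x :- y :- con 0ℚ := x :- y) refl (eval (w̃ ∘ map g) z) (eval (w̃ ∘ map h) z) ⟩
    eval (w̃ ∘ map g) z - eval (w̃ ∘ map h) z
      ≡⟨ cong₂ _-_ (eval-push g w z) (eval-push h w z) ⟨
    eval w (push g z) - eval w (push h z)
      ≡⟨ eval-⊖ w (push g z) (push h z) ⟨
    eval w (push g z ⊖ push h z) ∎
    where
    open ≡-Reasoning
    w̃ : Cochain _
    w̃ τ = eval w (sort τ)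
    W : Cochain _
    W σ = eval w̃ (prism h g σ)

Monotone : (Subset m → Subset k) → Set
Monotone g = ∀ {A B} → A <ˡ B → g A <ˡ g B

map-sorted : ∀ {g : Subset m → Subset k} → Monotone g → ∀ {σ} → Sorted σ → Sorted (map g σ)
map-sorted mono σ↗ = AllPairsₚ.map⁺ (AllPairs.map mono σ↗)

eval-push-monotone : ∀ {g : Subset m → Subset k} → Monotone g → ∀ w {z} → AllTerms Sorted z →
                     eval w (push g z) ≡ eval (w ∘ map g) z
eval-push-monotone {g = g} mono w {z} sorted = trans (eval-push g w z)
  (eval-cong-on (λ σ↗ → eval-sort-sorted w (map-sorted mono σ↗)) sorted)

-- Functoriality is needed only when one factor is an embedding. If that factor is monotone and acts
-- first, its images are sorted already; if it acts last, it commutes with `sort`.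
push-∘-monotoneʳ : ∀ {g : Subset m → Subset k} (h : Subset k → Subset ℓ) → Monotone g →
                   ∀ w {z} → AllTerms Sorted z → eval w (push h (push g z)) ≡ eval w (push (h ∘ g) z)
push-∘-monotoneʳ {g = g} h mono w {z} sorted = begin
  eval w (push h (push g z))                             ≡⟨ eval-push h w (push g z) ⟩
  eval (λ τ → eval w (sort (map h τ))) (push g z)        ≡⟨ eval-push-monotone mono _ sorted ⟩
  eval (λ σ → eval w (sort (map h (map g σ)))) z         ≡⟨ eval-cong (λ σ → cong (eval w ∘ sort) (Listₚ.map-∘ σ)) z ⟨
  eval (λ σ → eval w (sort (map (h ∘ g) σ))) z           ≡⟨ eval-push (h ∘ g) w z ⟨
  eval w (push (h ∘ g) z) ∎
  where open ≡-Reasoning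

push-∘-monotoneˡ : ∀ (g : Subset m → Subset k) {h : Subset k → Subset ℓ} → Monotone h →
                   ∀ w z → eval w (push h (push g z)) ≡ eval w (push (h ∘ g) z)
push-∘-monotoneˡ g {h} mono w z = begin
  eval w (push h (push g z))                             ≡⟨ eval-push-monotone mono w (push-sorted z) ⟩
  eval (w ∘ map h) (push g z)                            ≡⟨ eval-push g (w ∘ map h) z ⟩
  eval (λ σ → eval (w ∘ map h) (sort (map g σ))) z       ≡⟨ eval-cong (λ σ → sort-map mono w (map g σ)) z ⟨
  eval (λ σ → eval w (sort (map h (map g σ)))) z         ≡⟨ eval-cong (λ σ → cong (eval w ∘ sort) (Listₚ.map-∘ σ)) z ⟨
  eval (λ σ → eval w (sort (map (h ∘ g) σ))) z           ≡⟨ eval-push (h ∘ g) w z ⟨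
  eval w (push (h ∘ g) z) ∎
  where
  open ≡-Reasoning
  push-sorted : ∀ z → AllTerms Sorted (push g z)
  push-sorted [] = []
  push-sorted ((a , σ) ∷ z) = Allₚ.++⁺ (AllTerms-scale a (sort-sorted (map g σ))) (push-sorted z)

-- Embeddings of ground sets and maps that miss a point.

-- A k-subset of [m] as a sequence of choices. In this form `embed` only inserts `false` entries at
-- fixed positions, hence respects the lexicographic order.
data _⊑_ : ℕ → ℕ → Set where
  done : 0 ⊑ 0
  skip : k ⊑ m → k ⊑ suc m
  keep : k ⊑ m → suc k ⊑ suc m

apply : k ⊑ m → Fin k → Fin m
apply (skip θ) i = suc (apply θ i)
apply (keep θ) zero = zero
apply (keep θ) (suc i) = suc (apply θ i)

embed : k ⊑ m → Subset k → Subset m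
embed done A = A
embed (skip θ) A = false ∷ embed θ A
embed (keep θ) (b ∷ A) = b ∷ embed θ A

∣embed∣ : ∀ (θ : k ⊑ m) A → ∣ embed θ A ∣ ≡ ∣ A ∣
∣embed∣ done A = refl
∣embed∣ (skip θ) A = ∣embed∣ θ A
∣embed∣ (keep θ) (true ∷ A) = cong suc (∣embed∣ θ A)
∣embed∣ (keep θ) (false ∷ A) = ∣embed∣ θ A

∈-embed : ∀ (θ : k ⊑ m) {A i} → i ∈ A → apply θ i ∈ embed θ A
∈-embed (skip θ) p = there (∈-embed θ p)
∈-embed (keep θ) here = here
∈-embed (keep θ) (there p) = there (∈-embed θ p)

embed-carries : (θ : k ⊑ m) → Carries n (apply θ) (embed θ)
embed-carries θ {A} e = trans (∣embed∣ θ A) e , ∈-embed θ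

embed-monotone : (θ : k ⊑ m) → Monotone (embed θ)
embed-monotone (skip θ) p = there (embed-monotone θ p)
embed-monotone (keep θ) here = here
embed-monotone (keep θ) (there p) = there (embed-monotone θ p)

idθ : m ⊑ m
idθ {zero} = done
idθ {suc m} = keep idθ

apply-idθ : ∀ (i : Fin m) → apply idθ i ≡ i
apply-idθ zero = refl
apply-idθ (suc i) = cong suc (apply-idθ i)

omit : Fin (suc m) → m ⊑ suc m
omit zero = skip idθ
omit {suc m} (suc y) = keep (omit y)

apply-omit : ∀ (y x : Fin (suc m)) → x ≢ y → ∃ λ i → apply (omit y) i ≡ x
apply-omit zero zero x≢y = contradiction refl x≢y
apply-omit zero (suc x) _ = x , cong suc (apply-idθ x)
apply-omit {suc m} (suc y) zero _ = zero , refl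
apply-omit {suc m} (suc y) (suc x) x≢y with apply-omit y x (x≢y ∘ cong suc)
... | i , e = suc i , cong suc e

Misses : (Fin m → Fin k) → Set
Misses f = ∃ λ y → ∀ x → f x ≢ y

-- A map missing a point factors through k points, where all cycles bound.
push-misses : (∀ {c : Chain k} → Cycle n q c → ¬ ¬ Boundary n q c) → n ≤ k →
              ∀ {f : Fin m → Fin (suc k)} {h} → Misses f → Carries n f h →
              ∀ {z} → Cycle n q z → ¬ ¬ Boundary n q (push h z)
push-misses {n = n} acyclic n≤k {f} (y , f≢y) ch {z} cycle ¬b = acyclic (push-Cycle cg cycle) λ b →
  -- Both `h` and the composite through the smaller ground set carry `f`, so contiguity transfers
  -- the filling to `h`.
  ¬b (push-contiguous ch
    (Carries-cong (λ i → proj₂ (apply-omit y (f i) (f≢y i))) (Carries-∘ (embed-carries (omit y)) cg))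
    cycle
    (Boundary-cong (λ w → push-∘-monotoneˡ (vertexMap n p) (embed-monotone (omit y)) w z)
      (push-Boundary (embed-carries (omit y)) b)))
  where
  p : Fin _ → Fin _
  p i = proj₁ (apply-omit y (f i) (f≢y i))
  cg : Carries n p (vertexMap n p)
  cg = vertexMap-carries n≤k p

push-id : ∀ {f : Fin m → Fin m} {h} → (∀ i → f i ≡ i) → Carries n f h →
          ∀ w {z} → AllTerms (SortedWord n q) z → eval w (push h z) ≡ eval w z
push-id {n = n} {h = h} f≗id c w {z} words = trans (eval-push h w z) (eval-cong-on
  (λ { ((_ , sizes , _) , σ↗) → trans (cong (eval w ∘ sort) (map-fix sizes)) (eval-sort-sorted w σ↗) }) words)
  where
  map-fix : ∀ {σ} → All (λ A → ∣ A ∣ ≡ n) σ → map h σ ≡ σ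
  map-fix [] = refl
  map-fix (e ∷ es) with Carries-cong f≗id c e
  ... | e′ , A⊆hA = cong₂ _∷_ (sym (⊆∧∣∣≡⇒≡ A⊆hA (trans e (sym e′)))) (map-fix es)

-- Linear combinations and independence.

∑ : ∀ k → (Fin k → ℚ) → ℚ
∑ zero F = 0ℚ
∑ (suc k) F = F zero +ℚ ∑ k (F ∘ suc)

∑-cong : ∀ k {F G : Fin k → ℚ} → (∀ i → F i ≡ G i) → ∑ k F ≡ ∑ k G
∑-cong zero e = refl
∑-cong (suc k) e = cong₂ _+ℚ_ (e zero) (∑-cong k (e ∘ suc))

∑-0 : ∀ k → ∑ k (λ _ → 0ℚ) ≡ 0ℚ
∑-0 zero = refl
∑-0 (suc k) = cong (0ℚ +ℚ_) (∑-0 k)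

∑-splitAt : ∀ j k (F : Fin (j + k) → ℚ) → ∑ (j + k) F ≡ ∑ j (λ i → F (i ↑ˡ k)) +ℚ ∑ k (λ i → F (j ↑ʳ i))
∑-splitAt zero k F = sym (ℚₚ.+-identityˡ (∑ k F))
∑-splitAt (suc j) k F = trans (cong (F zero +ℚ_) (∑-splitAt j k (F ∘ suc)))
  (sym (ℚₚ.+-assoc (F zero) (∑ j (λ i → F (suc (i ↑ˡ k)))) (∑ k (λ i → F (suc (j ↑ʳ i))))))

eval-lincomb : ∀ w k a (z : Fin k → Chain m) → eval w (lincomb k a z) ≡ ∑ k (λ i → a i *ℚ eval w (z i))
eval-lincomb w zero a z = refl
eval-lincomb w (suc k) a z = trans (eval-++ w (scale (a zero) (z zero)) (lincomb k (a ∘ suc) (z ∘ suc)))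
  (cong₂ _+ℚ_ (eval-scale w (a zero) (z zero)) (eval-lincomb w k (a ∘ suc) (z ∘ suc)))

eval-push-lincomb : ∀ (g : Subset m → Subset ℓ) w k a z →
                    eval w (push g (lincomb k a z)) ≡ eval w (lincomb k a (push g ∘ z))
eval-push-lincomb g w k a z = begin
  eval w (push g (lincomb k a z))                   ≡⟨ eval-push g w (lincomb k a z) ⟩
  eval (λ σ → eval w (sort (map g σ))) (lincomb k a z) ≡⟨ eval-lincomb _ k a z ⟩
  ∑ k (λ i → a i *ℚ eval (λ σ → eval w (sort (map g σ))) (z i))
    ≡⟨ ∑-cong k (λ i → cong (a i *ℚ_) (eval-push g w (z i))) ⟨
  ∑ k (λ i → a i *ℚ eval w (push g (z i)))          ≡⟨ eval-lincomb w k a (push g ∘ z) ⟨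
  eval w (lincomb k a (push g ∘ z)) ∎
  where open ≡-Reasoning

¬¬Boundary-lincomb : ∀ k (a : Fin k → ℚ) {z : Fin k → Chain m} →
                     (∀ i → ¬ ¬ Boundary n q (z i)) → ¬ ¬ Boundary n q (lincomb k a z)
¬¬Boundary-lincomb zero a b ¬b = ¬b Boundary-[]
¬¬Boundary-lincomb (suc k) a b ¬b = b zero λ b₀ → ¬¬Boundary-lincomb k (a ∘ suc) (b ∘ suc) λ bₛ →
  ¬b (Boundary-++ (Boundary-scale (a zero) b₀) bₛ)

Independent : ℕ → ℕ → ∀ k → (Fin k → Chain m) → Set
Independent n q k z = ∀ a → Boundary n q (lincomb k a z) → ∀ i → a i ≡ 0ℚ

infixr 5 _++ᶠ_
_++ᶠ_ : ∀ {j k} → (Fin j → Chain m) → (Fin k → Chain m) → Fin (j + k) → Chain m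
_++ᶠ_ {j = j} z z′ i = [ z , z′ ]′ (splitAt j i)

++ᶠ-elim : ∀ {j k} {z : Fin j → Chain m} {z′ : Fin k → Chain m} (P : Chain m → Set) →
           (∀ i → P (z i)) → (∀ i → P (z′ i)) → ∀ i → P ((z ++ᶠ z′) i)
++ᶠ-elim {j = j} P p p′ i with splitAt j i
... | inj₁ x = p x
... | inj₂ y = p′ y

eval-lincomb-++ᶠ : ∀ w j k a (z : Fin j → Chain m) (z′ : Fin k → Chain m) →
                   eval w (lincomb (j + k) a (z ++ᶠ z′)) ≡
                   eval w (lincomb j (λ i → a (i ↑ˡ k)) z) +ℚ eval w (lincomb k (λ i → a (j ↑ʳ i)) z′)
eval-lincomb-++ᶠ w j k a z z′ = begin
  eval w (lincomb (j + k) a (z ++ᶠ z′))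
    ≡⟨ eval-lincomb w (j + k) a (z ++ᶠ z′) ⟩
  ∑ (j + k) (λ i → a i *ℚ eval w ((z ++ᶠ z′) i))
    ≡⟨ ∑-splitAt j k (λ i → a i *ℚ eval w ((z ++ᶠ z′) i)) ⟩
  ∑ j (λ i → a (i ↑ˡ k) *ℚ eval w ((z ++ᶠ z′) (i ↑ˡ k))) +ℚ ∑ k (λ i → a (j ↑ʳ i) *ℚ eval w ((z ++ᶠ z′) (j ↑ʳ i)))
    ≡⟨ cong₂ _+ℚ_
         (∑-cong j (λ i → cong (λ s → a (i ↑ˡ k) *ℚ eval w ([ z , z′ ]′ s)) (Finₚ.splitAt-↑ˡ j i k)))
         (∑-cong k (λ i → cong (λ s → a (j ↑ʳ i) *ℚ eval w ([ z , z′ ]′ s)) (Finₚ.splitAt-↑ʳ j k i))) ⟩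
  ∑ j (λ i → a (i ↑ˡ k) *ℚ eval w (z i)) +ℚ ∑ k (λ i → a (j ↑ʳ i) *ℚ eval w (z′ i))
    ≡⟨ cong₂ _+ℚ_ (eval-lincomb w j _ z) (eval-lincomb w k _ z′) ⟨
  eval w (lincomb j (λ i → a (i ↑ˡ k)) z) +ℚ eval w (lincomb k (λ i → a (j ↑ʳ i)) z′) ∎
  where open ≡-Reasoning

-- One step of triangular elimination. Pushing a relation along `g` leaves, up to boundaries, a
-- relation among the images of `z`, whose coefficients must vanish; what remains is a relation
-- among `z′`.
Independent-++ᶠ : ∀ {f : Fin m → Fin ℓ} {g} → Carries n f g → ∀ {j k} {z : Fin j → Chain m} {z′ : Fin k → Chain m} →
                  Independent n q j (push g ∘ z) → (∀ i → ¬ ¬ Boundary n q (push g (z′ i))) →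
                  Independent n q k z′ → Independent n q (j + k) (z ++ᶠ z′)
Independent-++ᶠ {g = g} c {j} {k} {z} {z′} ind kill ind′ a b i =
  subst (λ i → a i ≡ 0ℚ) (Finₚ.join-splitAt j k i) (on-join (splitAt j i))
  where
  a₁ = λ x → a (x ↑ˡ k)
  a₂ = λ y → a (j ↑ʳ y)
  pushed : ∀ w → eval w (lincomb j a₁ (push g ∘ z)) ≡
                 eval w (push g (lincomb (j + k) a (z ++ᶠ z′))) - eval w (lincomb k a₂ (push g ∘ z′))
  pushed w = sym (begin
    eval w (push g (lincomb (j + k) a (z ++ᶠ z′))) - Y
      ≡⟨ cong (λ x → x - Y) (eval-push g w (lincomb (j + k) a (z ++ᶠ z′))) ⟩
    eval w̃ (lincomb (j + k) a (z ++ᶠ z′)) - Y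
      ≡⟨ cong (λ x → x - Y) (eval-lincomb-++ᶠ w̃ j k a z z′) ⟩
    eval w̃ (lincomb j a₁ z) +ℚ eval w̃ (lincomb k a₂ z′) - Y
      ≡⟨ cong (λ x → x - Y) (cong₂ _+ℚ_
           (trans (sym (eval-push g w (lincomb j a₁ z))) (eval-push-lincomb g w j a₁ z))
           (trans (sym (eval-push g w (lincomb k a₂ z′))) (eval-push-lincomb g w k a₂ z′))) ⟩
    X +ℚ Y - Y
      ≡⟨ solve 2 (λ x y → x :+ y :- y := x) refl X Y ⟩
    X ∎)
    where
    open ≡-Reasoning
    w̃ : Cochain _
    w̃ σ = eval w (sort (map g σ))
    X = eval w (lincomb j a₁ (push g ∘ z))
    Y = eval w (lincomb k a₂ (push g ∘ z′))
  a₁≡0 : ∀ x → a₁ x ≡ 0ℚ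
  -- The goal is a decidable equation, so fillings known only up to double negation may be used.
  a₁≡0 x = decidable-stable (a₁ x ℚₚ.≟ 0ℚ) λ a₁x≢0 → ¬¬Boundary-lincomb k a₂ kill λ b₂ →
    a₁x≢0 (ind a₁ (Boundary-difference (push-Boundary c b) b₂ pushed) x)
  a₂≡0 : ∀ y → a₂ y ≡ 0ℚ
  a₂≡0 = ind′ a₂ (Boundary-cong (λ w → begin
    eval w (lincomb (j + k) a (z ++ᶠ z′))                     ≡⟨ eval-lincomb-++ᶠ w j k a z z′ ⟩
    eval w (lincomb j a₁ z) +ℚ eval w (lincomb k a₂ z′)       ≡⟨ cong (_+ℚ eval w (lincomb k a₂ z′)) (first-vanishes w) ⟩
    0ℚ +ℚ eval w (lincomb k a₂ z′)                            ≡⟨ ℚₚ.+-identityˡ (eval w (lincomb k a₂ z′)) ⟩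
    eval w (lincomb k a₂ z′) ∎) b)
    where
    open ≡-Reasoning
    first-vanishes : ∀ w → eval w (lincomb j a₁ z) ≡ 0ℚ
    first-vanishes w = begin
      eval w (lincomb j a₁ z)                   ≡⟨ eval-lincomb w j a₁ z ⟩
      ∑ j (λ x → a₁ x *ℚ eval w (z x))          ≡⟨ ∑-cong j (λ x → trans (cong (_*ℚ eval w (z x)) (a₁≡0 x)) (ℚₚ.*-zeroˡ (eval w (z x)))) ⟩
      ∑ j (λ _ → 0ℚ)                            ≡⟨ ∑-0 j ⟩
      0ℚ ∎
  on-join : ∀ s → a (join j k s) ≡ 0ℚ
  on-join (inj₁ x) = a₁≡0 x
  on-join (inj₂ y) = a₂≡0 y

-- A triangular system of projections.

-- An ℓ-subset of [m], encoded by its increasing enumeration, and a map onto it.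
Projection : ℕ → ℕ → Set
Projection ℓ m = ℓ ⊑ m × (Fin m → Fin ℓ)

-- An entry of a matrix of self-maps of [ℓ]. `Retracts` makes a diagonal entry the identity; `Kills`
-- makes an entry miss a point, hence zero in homology when ℓ is minimal.
_⊙_ : Projection ℓ m → Projection ℓ m → Fin ℓ → Fin ℓ
(_ , ρ) ⊙ (θ , _) = ρ ∘ apply θ

Retracts : Projection ℓ m → Set
Retracts p = ∀ i → (p ⊙ p) i ≡ i

Kills : Projection ℓ m → Projection ℓ m → Set
Kills p p′ = Misses (p ⊙ p′)

last⊑ : 1 ⊑ suc m
last⊑ {zero} = keep done
last⊑ {suc m} = skip last⊑

keepᵖ : Projection ℓ m → Projection (suc ℓ) (suc m)
keepᵖ (θ , ρ) = keep θ , lift 1 ρ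

skipᵖ : Projection (suc ℓ) m → Projection (suc ℓ) (suc m)
-- The new first point lies below the whole subset, so it goes to the least element, whose index is
-- zero.
skipᵖ (θ , ρ) = skip θ , λ { zero → zero ; (suc i) → ρ i }

-- One projection for each (ℓ+1)-subset S of [m+1] containing the last point;
-- the map sends x to the least element of S that is ≥ x.
projections : ∀ m ℓ → List (Projection (suc ℓ) (suc m))
projections m zero = (last⊑ , λ _ → zero) ∷ []
projections zero (suc ℓ) = []
projections (suc m) (suc ℓ) = map keepᵖ (projections m ℓ) ++ map skipᵖ (projections m (suc ℓ))

length-projections : ∀ m ℓ → length (projections m ℓ) ≡ m C ℓ
length-projections m zero = sym (nC0≡1 m)
  where
  nC0≡1 : ∀ m → m C 0 ≡ 1
  nC0≡1 m = trans (nCk≡nC[n∸k] {0} {m} z≤n) (nCn≡1 m)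
length-projections zero (suc ℓ) = sym (k>n⇒nCk≡0 {0} {suc ℓ} (s≤s z≤n))
length-projections (suc m) (suc ℓ) = begin
  length (map keepᵖ (projections m ℓ) ++ map skipᵖ (projections m (suc ℓ)))
    ≡⟨ Listₚ.length-++ (map keepᵖ (projections m ℓ)) ⟩
  length (map keepᵖ (projections m ℓ)) + length (map skipᵖ (projections m (suc ℓ)))
    ≡⟨ cong₂ _+_ (Listₚ.length-map keepᵖ (projections m ℓ)) (Listₚ.length-map skipᵖ (projections m (suc ℓ))) ⟩
  length (projections m ℓ) + length (projections m (suc ℓ))
    ≡⟨ cong₂ _+_ (length-projections m ℓ) (length-projections m (suc ℓ)) ⟩
  m C ℓ + m C suc ℓ
    ≡⟨ nCk+nC[k+1]≡[n+1]C[k+1] m ℓ ⟩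
  suc m C suc ℓ ∎
  where open ≡-Reasoning

projections-retract : ∀ m ℓ → All Retracts (projections m ℓ)
projections-retract m zero = (λ { zero → refl }) ∷ []
projections-retract zero (suc ℓ) = []
projections-retract (suc m) (suc ℓ) = Allₚ.++⁺
  (Allₚ.map⁺ (All.map (λ e → λ { zero → refl ; (suc i) → cong suc (e i) }) (projections-retract m ℓ)))
  (Allₚ.map⁺ (All.map (λ e i → e i) (projections-retract m (suc ℓ))))

-- Subsets containing the first point are listed before those avoiding it. Within each of the two
-- groups the missed point comes from the recursion.
projections-triangular : ∀ m ℓ → AllPairs Kills (projections m ℓ)
projections-triangular m zero = [] ∷ []
projections-triangular zero (suc ℓ) = []
projections-triangular (suc m) (suc ℓ) = AllPairsₚ.++⁺
  (AllPairsₚ.map⁺ (AllPairs.map (λ {p} {p′} → keep-kills {p} {p′}) (projections-triangular m ℓ)))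
  (AllPairsₚ.map⁺ (AllPairs.map (λ k → k) (projections-triangular m (suc ℓ))))
  -- For a subset containing the first point, only that point is sent to zero; the later subset
  -- avoids it, so zero is missed.
  (Allₚ.map⁺ (All.universal (λ _ → Allₚ.map⁺ (All.universal (λ _ → zero , λ _ ()) _)) _))
  where
  keep-kills : ∀ {p p′ : Projection (suc ℓ) (suc m)} → Kills p p′ → Kills (keepᵖ p) (keepᵖ p′)
  keep-kills (y , y-missed) = suc y , λ { zero () ; (suc i) e → y-missed i (Finₚ.suc-injective e) }

-- Independent copies of the cycles.

module _ (n q r : ℕ) (n≤ℓ : n ≤ ℓ)
         (acyclic : ∀ {c : Chain ℓ} → Cycle n q c → ¬ ¬ Boundary n q c)
         (z : Fin r → Chain (suc ℓ)) (z-cycle : ∀ j → Cycle n q (z j)) (z-independent : Independent n q r z) where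

  family : (ps : List (Projection (suc ℓ) m)) → Fin (length ps * r) → Chain m
  family [] ()
  family ((θ , _) ∷ ps) = (λ j → push (embed θ) (z j)) ++ᶠ family ps

  family-elim : (P : Chain m → Set) → ∀ {ps} → All (λ p → ∀ j → P (push (embed (proj₁ p)) (z j))) ps →
                ∀ i → P (family ps i)
  family-elim P (h ∷ hs) = ++ᶠ-elim P h (family-elim P hs)

  family-cycles : ∀ (ps : List (Projection (suc ℓ) m)) i → Cycle n q (family ps i)
  family-cycles ps = family-elim (Cycle n q) {ps}
    (All.universal (λ (θ , _) j → push-Cycle (embed-carries θ) (z-cycle j)) ps)

  -- The map `ρ` of the first projection returns the original cycles from its own copies and
  -- annihilates all later ones, so elimination proceeds along the list.
  family-independent : ∀ {ps : List (Projection (suc ℓ) m)} → All Retracts ps → AllPairs Kills ps →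
                       Independent n q (length ps * r) (family ps)
  family-independent [] [] a b ()
  family-independent {m} {p@(θ , ρ) ∷ ps} (retracts ∷ rs) (kills ∷ ks) =
    Independent-++ᶠ ρ-carries detected
      (family-elim (λ c → ¬ ¬ Boundary n q (push g c)) (All.map (λ {p′} → killed {p′}) kills))
      (family-independent rs ks)
    where
    g : Subset m → Subset (suc ℓ)
    g = vertexMap n ρ
    ρ-carries : Carries n ρ g
    ρ-carries = vertexMap-carries (ℕₚ.m≤n⇒m≤1+n n≤ℓ) ρ
    push-push : ∀ (θ : suc ℓ ⊑ m) w j → eval w (push g (push (embed θ) (z j))) ≡ eval w (push (g ∘ embed θ) (z j))
    push-push θ w j = push-∘-monotoneʳ g (embed-monotone θ) w (All.map proj₂ (proj₁ (z-cycle j)))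
    detected : Independent n q r (λ j → push g (push (embed θ) (z j)))
    detected a b = z-independent a (Boundary-cong (λ w → begin
      eval w (lincomb r a (λ j → push g (push (embed θ) (z j))))   ≡⟨ eval-lincomb w r a _ ⟩
      ∑ r (λ j → a j *ℚ eval w (push g (push (embed θ) (z j))))    ≡⟨ ∑-cong r (λ j → cong (a j *ℚ_) (trans (push-push θ w j)
        (push-id retracts (Carries-∘ ρ-carries (embed-carries θ)) w (proj₁ (z-cycle j))))) ⟩
      ∑ r (λ j → a j *ℚ eval w (z j))                              ≡⟨ eval-lincomb w r a z ⟨
      eval w (lincomb r a z) ∎) b)
      where open ≡-Reasoning
    killed : ∀ {p′} → Kills p p′ → ∀ j → ¬ ¬ Boundary n q (push g (push (embed (proj₁ p′)) (z j)))
    killed {θ′ , _} misses j ¬b =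
      push-misses acyclic n≤ℓ misses (Carries-∘ ρ-carries (embed-carries θ′)) (z-cycle j) λ b →
      ¬b (Boundary-cong (λ w → sym (push-push θ′ w j)) b)

-- A cycle that does not bound is by itself an independent family: if a multiple with nonzero
-- coefficient bounded, dividing would fill the cycle.
¬Nontrivial⇒acyclic : 1 ≤ n → ¬ Nontrivial m n (2 * (n ∸ 1)) q →
                      ∀ {c : Chain m} → Cycle n q c → ¬ ¬ Boundary n q c
¬Nontrivial⇒acyclic 1≤n trivial {c} cycle ¬b =
  trivial ((λ _ → c) , (λ _ → Cycle⇒IsCycle 1≤n cycle) , λ { a b zero → vanish a (IsBoundary⇒Boundary 1≤n b) })
  where
  vanish : ∀ a → Boundary _ _ (lincomb 1 a (λ _ → c)) → a zero ≡ 0ℚ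
  vanish a b with a zero ℚₚ.≟ 0ℚ
  ... | yes a≡0 = a≡0
  ... | no a≢0 = ⊥-elim (¬b (Boundary-cong (λ w → begin
    eval w (scale a⁻¹ (lincomb 1 a (λ _ → c)))      ≡⟨ eval-scale w a⁻¹ (lincomb 1 a (λ _ → c)) ⟩
    a⁻¹ *ℚ eval w (lincomb 1 a (λ _ → c))           ≡⟨ cong (a⁻¹ *ℚ_) (eval-lincomb w 1 a (λ _ → c)) ⟩
    a⁻¹ *ℚ (a zero *ℚ eval w c +ℚ 0ℚ)               ≡⟨ solve 3 (λ x y z → x :* (y :* z :+ con 0ℚ) := (x :* y) :* z) refl a⁻¹ (a zero) (eval w c) ⟩
    (a⁻¹ *ℚ a zero) *ℚ eval w c                     ≡⟨ cong (_*ℚ eval w c) (ℚₚ.*-inverseˡ (a zero)) ⟩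
    1ℚ *ℚ eval w c                                  ≡⟨ ℚₚ.*-identityˡ (eval w c) ⟩
    eval w c ∎) (Boundary-scale a⁻¹ b)))
    where
    open ≡-Reasoning
    instance _ = ≢-nonZero a≢0
    a⁻¹ = 1/ a zero

-- For ℓ = n there is only one vertex, hence no simplex of dimension q ≥ 1.
Nontrivial⇒n≢ℓ : 1 ≤ q → ∀ {r} → Nontrivial ℓ n r q → n ≢ ℓ
Nontrivial⇒n≢ℓ {ℓ = ℓ} (s≤s _) {r} (z , cycles , ind) refl =
  -- The given cycle has no terms, so with coefficient 1 it is filled by the empty chain, and
  -- independence would force 1 = 0.
  contradiction (ind (λ _ → 1ℚ) ([] , [] , λ τ → cong (λ c → coeff (scale 1ℚ c ++ []) τ) (sym (no-terms (proj₁ (cycles zero))))) zero) λ ()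
  where
  no-terms : ∀ {c q} → IsChain ℓ ℓ r (suc q) c → c ≡ []
  no-terms [] = refl
  no-terms {(_ , _ ∷ []) ∷ _} ((() , _) ∷ _)
  no-terms {(_ , A ∷ B ∷ _) ∷ _} ((_ , (a ∷ b ∷ _) , ((A<B , _) ∷ _) ∷ _) ∷ _) =
    ⊥-elim (<ˡ-irrefl (subst (A <ˡ_) (trans (Subsetₚ.∣p∣≡n⇒p≡⊤ b) (sym (Subsetₚ.∣p∣≡n⇒p≡⊤ a))) A<B))

-- Counting the copies and conclusion.

-- Induction on `k` by Pascal's rule, with ℓ = 2 + l and m = ℓ + k. In these variables the summand
-- reduces to `(l + j) C l`, free of truncated subtraction.
hockey-stick : ∀ l k → sumFromTo (2 + l) (2 + l + k) (λ i → (i ∸ 2) C l) ≡ (1 + l + k) C (1 + l)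
hockey-stick l k = trans (cong (λ d → sum (map f (upTo d))) length-range) (go k)
  where
  open ≡-Reasoning
  f : ℕ → ℕ
  f j = (l + j) C l
  length-range : suc (2 + l + k) ∸ (2 + l) ≡ suc k
  length-range = trans (cong (_∸ (2 + l)) (sym (ℕₚ.+-suc (2 + l) k))) (ℕₚ.m+n∸m≡n (2 + l) (suc k))
  go : ∀ k → sum (map f (upTo (suc k))) ≡ (1 + l + k) C (1 + l)
  go zero = begin
    f 0 + 0                         ≡⟨ ℕₚ.+-identityʳ (f 0) ⟩
    (l + 0) C l                     ≡⟨ cong (_C l) (ℕₚ.+-identityʳ l) ⟩
    l C l                           ≡⟨ nCn≡1 l ⟩
    1                               ≡⟨ nCn≡1 (1 + l) ⟨
    (1 + l) C (1 + l)               ≡⟨ cong (_C (1 + l)) (ℕₚ.+-identityʳ (1 + l)) ⟨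
    (1 + l + 0) C (1 + l) ∎
  go (suc k) = begin
    sum (map f (upTo (suc (suc k))))                ≡⟨ cong (sum ∘ map f) (Listₚ.upTo-∷ʳ (suc k)) ⟨
    sum (map f (upTo (suc k) ++ suc k ∷ []))        ≡⟨ cong sum (Listₚ.map-++ f (upTo (suc k)) (suc k ∷ [])) ⟩
    sum (map f (upTo (suc k)) ++ f (suc k) ∷ [])    ≡⟨ sum-++ (map f (upTo (suc k))) (f (suc k) ∷ []) ⟩
    sum (map f (upTo (suc k))) + (f (suc k) + 0)    ≡⟨ cong₂ _+_ (go k) (ℕₚ.+-identityʳ (f (suc k))) ⟩
    (1 + l + k) C (1 + l) + (l + suc k) C l         ≡⟨ cong (λ x → (1 + l + k) C (1 + l) + x C l) (ℕₚ.+-suc l k) ⟩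
    (1 + l + k) C (1 + l) + (1 + l + k) C l         ≡⟨ ℕₚ.+-comm ((1 + l + k) C (1 + l)) ((1 + l + k) C l) ⟩
    (1 + l + k) C l + (1 + l + k) C (1 + l)         ≡⟨ nCk+nC[k+1]≡[n+1]C[k+1] (1 + l + k) l ⟩
    (2 + l + k) C (1 + l)                           ≡⟨ cong (_C (1 + l)) (ℕₚ.+-suc (1 + l) k) ⟨
    (1 + l + suc k) C (1 + l) ∎

theorem5p2 : (n q ℓ : ℕ) → 1 ≤ n → 1 ≤ q → n ≤ ℓ →
    Nontrivial ℓ n (2 * (n ∸ 1)) q →
    (∀ ℓ′ → n ≤ ℓ′ → ℓ′ < ℓ → ¬ Nontrivial ℓ′ n (2 * (n ∸ 1)) q) →
    (r : ℕ) → RankEq ℓ n (2 * (n ∸ 1)) q r →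
    (m : ℕ) → ℓ ≤ m →
    RankAtLeast m n (2 * (n ∸ 1)) q
    (sumFromTo ℓ m (λ i → (i ∸ 2) C (ℓ ∸ 2)) * r)
theorem5p2 n q ℓ 1≤n 1≤q n≤ℓ nontrivial minimal r rank m ℓ≤m
  -- Since n < ℓ, minimality can be applied at ℓ - 1, and ℓ - 1 points still suffice for padding to
  -- n-sets. Together with n ≥ 1 this gives ℓ ≥ 2.
  with ℕₚ.≤∧≢⇒< n≤ℓ (Nontrivial⇒n≢ℓ 1≤q nontrivial)
theorem5p2 n@(suc _) q (suc (suc l)) 1≤n 1≤q n≤ℓ nontrivial minimal r ((z , z-cycles , z-ind) , _) m ℓ≤m
  | s≤s n≤ℓ-1 with k , refl ← ℕₚ.m≤n⇒∃[o]m+o≡n ℓ≤m =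
  subst (λ N → RankAtLeast m n (2 * (n ∸ 1)) q (N * r))
    (trans (length-projections (1 + l + k) (1 + l)) (sym (hockey-stick l k)))
    (family′ ps , (λ i → Cycle⇒IsCycle 1≤n (family-cycles n q r n≤ℓ-1 acyclic z cycles independent ps i)) ,
     λ a b → family-independent n q r n≤ℓ-1 acyclic z cycles independent
       (projections-retract (1 + l + k) (1 + l)) (projections-triangular (1 + l + k) (1 + l))
       a (IsBoundary⇒Boundary 1≤n b))
  where
  -- Both arguments are one less than m and ℓ, since every listed subset contains the last point.
  ps = projections (1 + l + k) (1 + l)
  acyclic : ∀ {c : Chain (suc l)} → Cycle n q c → ¬ ¬ Boundary n q c
  acyclic = ¬Nontrivial⇒acyclic 1≤n (minimal (suc l) n≤ℓ-1 ℕₚ.≤-refl)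
  cycles : ∀ j → Cycle n q (z j)
  cycles j = IsCycle⇒Cycle 1≤n (z-cycles j)
  independent : Independent n q r z
  independent a b = z-ind a (Boundary⇒IsBoundary 1≤n b)
  family′ = family n q r n≤ℓ-1 acyclic z cycles independent
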